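{- Let $h=\hat h\circ\tilde h:\Sigma^c\to\mathcal R$ be a random tornado tabulation hash function with $d$ derived characters. There exists a selector function $f$ with $\mu^f\le|\Sigma|/2$ such that the set of derived selected keys $\tilde h(X^{f,h})$ is linearly dependent with probability at least $\Omega((3/|\Sigma|)^{d-2})$.
   Context: Let $\Sigma=\{0,1,\dots,2^k-1\}$, identified with $k$-bit strings, $\oplus$ bitwise xor; throughout $|\Sigma|\ge2^8$; $\mathcal R=\{0,\dots,2^r-1\}$. A simple tabulation hash function $g:\Sigma^b\to\mathcal R'$ is $g(x_1\cdots x_b)=T_1[x_1]\oplus\cdots\oplus T_b[x_b]$ with independent fully random tables $T_i:\Sigma\to\mathcal R'$. A random tornado tabulation hash function $h:\Sigma^c\to\mathcal R$ with $d\ge1$ derived characters consists of mutually independent simple tabulation functions $\tilde h_i:\Sigma^{c+i-1}\to\Sigma$ ($i=0,\dots,d$) and $\hat h:\Sigma^{c+d}\to\mathcal R$; the derived key of $x=x_1\cdots x_c$ is $\tilde h(x)=\tilde x_1\cdots\tilde x_{c+d}$ with $\tilde x_i=x_i$ ($i<c$), $\tilde x_c=x_c\oplus\tilde h_0(\tilde x_1\cdots\tilde x_{c-1})$, $\tilde x_i=\tilde h_{i-c}(\tilde x_1\cdots\tilde x_{i-1})$ ($c<i\le c+d$); $h(x)=\hat h(\tilde h(x))$. A selector function with query keys $Q\subseteq\Sigma^c$ is $f:\Sigma^c\times\mathcal R\times\mathcal R^Q\to\{0,1\}$ with $f(q,\cdot,\cdot)=1$ for $q\in Q$; $X^{f,h}=\{x: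 f(x,h(x),h|_Q)=1\}$; $p^f_x=\max_{\varphi\in\mathcal R^Q}\Pr_{r\sim\mathcal U(\mathcal R)}[f(x,r,\varphi)=1]$; $\mu^f=\sum_x p^f_x$. A set $Y\subseteq\Sigma^b$ is linearly dependent if some nonempty $Y'\subseteq Y$ has, at every position, every character appearing an even number of times among the keys of $Y'$.
   Formalization: Assumes c ≥ 2 (for c = 1 derived keys are never dependent); for d = 1 the bound is read as Ω(1), since Ω(|Σ|/3) is impossible; the Ω constant is uniform over all d ≤ K|Σ| for each fixed K, since no constant serves all d at fixed |Σ|. -}

module Defs where

open import Algebra.Definitions.RawSemiring using (_^_)
open import Data.Bool as Bool using (Bool; true; false; _xor_; if_then_else_)
open import Data.Fin as Fin using (Fin; combine)
import Data.Fin.Properties as Fin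
open import Data.Integer using (+_)
open import Data.List as List using (List; []; _∷_; _++_; length; map; filter; filterᵇ; foldr; cartesianProduct; cartesianProductWith; deduplicate)
open import Data.List.Membership.Propositional using (_∈_; lose)
open import Data.List.Membership.Propositional.Properties using (∈-filter⁺; ∈-filter⁻; ∈-map⁺; ∈-++⁺ˡ; ∈-++⁺ʳ; ∈-deduplicate⁺)
import Data.List.Membership.DecPropositional as DecMembership
open import Data.List.Relation.Binary.BagAndSetEquality using (∼bag⇒↭)
open import Data.List.Membership.Propositional.Properties.WithK using (unique∧set⇒bag)
open import Data.List.Relation.Binary.Permutation.Propositional using (_↭_; ↭-sym)
open import Data.List.Relation.Binary.Permutation.Propositional.Properties using (↭-length; filter-↭; ↭-empty-inv)
open import Data.List.Relation.Unary.All as All using (All)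
open import Data.List.Relation.Unary.Any as Any using (Any; here; there)
open import Data.List.Relation.Unary.Unique.Propositional using (Unique)
import Data.List.Relation.Unary.Unique.Propositional.Properties as Unique
import Data.List.Relation.Unary.Unique.DecPropositional as DecUnique
import Data.List.Relation.Unary.Unique.DecPropositional.Properties as DecUnique
open import Data.Nat as ℕ using (ℕ; zero; suc)
open import Data.Nat.Divisibility using (_∣_; _∣?_)
import Data.Nat.Properties as ℕ
open import Data.Product using (∃; _×_; _,_; proj₁; proj₂)
open import Data.Rational using (ℚ; 0ℚ; _/_; _+_; _⊔_; +-*-rawSemiring)
open import Data.Vec as Vec using (Vec; []; _∷_; _∷ʳ_; zipWith; lookup; replicate; init; last)
import Data.Vec.Properties as Vec
open import Function using (_∘_; mk⇔)
open import Relation.Binary.Definitions using (DecidableEquality)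
open import Relation.Binary.PropositionalEquality using (_≡_; _≢_; refl; sym; subst)
open import Relation.Nullary using (Dec; yes; no; ¬?; _×-dec_)
open import Relation.Nullary.Decidable using (map′)
open import Relation.Unary using (Decidable)

-- Bits k is the alphabet Σ = {0,…,2ᵏ−1}, and Bits r the range 𝓡.

Bits : ℕ → Set
Bits k = Vec Bool k

infixl 6 _⊕_

_⊕_ : ∀ {k} → Bits k → Bits k → Bits k
_⊕_ = zipWith _xor_

_≟ᵇ_ : ∀ {k} → DecidableEquality (Bits k)
_≟ᵇ_ = Vec.≡-dec Bool._≟_

index : ∀ {k} → Bits k → Fin (2 ℕ.^ k)
index []      = Fin.zero
index (b ∷ x) = combine {2} (if b then Fin.suc Fin.zero else Fin.zero) (index x)

Key : ℕ → ℕ → Set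
Key k c = Vec (Bits k) c

_≟ᵏ_ : ∀ {k c} → DecidableEquality (Key k c)
_≟ᵏ_ = Vec.≡-dec _≟ᵇ_

-- A uniform distribution on a finite type is given by a duplicate-free list
-- of all its elements; mutually independent choices are cartesian products.

allVec : ∀ {A : Set} → List A → ∀ n → List (Vec A n)
allVec xs zero    = [] ∷ []
allVec xs (suc n) = cartesianProductWith _∷_ xs (allVec xs n)

allBits : ∀ k → List (Bits k)
allBits = allVec (false ∷ true ∷ [])

allKeys : ∀ k c → List (Key k c)
allKeys k = allVec (allBits k)

-- The value on [] is a dummy: every list used below is non-empty.

Pr : ∀ {A : Set} {P : A → Set} → List A → Decidable P → ℚ
Pr []         P? = 0ℚ
Pr xs@(_ ∷ _) P? = + length (filter P? xs) / length xs

Table : ℕ → ℕ → Set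
Table k r = Vec (Bits r) (2 ℕ.^ k)

_[_] : ∀ {k r} → Table k r → Bits k → Bits r
T [ a ] = lookup T (index a)

Simple : ℕ → ℕ → ℕ → Set
Simple k r b = Vec (Table k r) b

simple : ∀ {k r b} → Simple k r b → Key k b → Bits r
simple []       []      = replicate _ false
simple (T ∷ Ts) (a ∷ x) = T [ a ] ⊕ simple Ts x

allSimple : ∀ k r b → List (Simple k r b)
allSimple k r = allVec (allVec (allBits r) (2 ℕ.^ k))

-- The tables of h̃₀, …, h̃_d, where h̃ᵢ reads c + i − 1 characters.

Derivers : ℕ → ℕ → ℕ → Set
Derivers k c zero    = Simple k k (ℕ.pred c)
Derivers k c (suc d) = Derivers k c d × Simple k k (d ℕ.+ c)

allDerivers : ∀ k c d → List (Derivers k c d)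
allDerivers k c zero    = allSimple k k (ℕ.pred c)
allDerivers k c (suc d) = cartesianProduct (allDerivers k c d) (allSimple k k (d ℕ.+ c))

-- Replaces x_c by x_c ⊕ h̃₀(x₁⋯x_{c−1}); only c ≥ 1 is meaningful.

twist : ∀ {k} c → Simple k k (ℕ.pred c) → Key k c → Key k c
twist zero    T x = x
twist (suc _) T x = init x ∷ʳ (last x ⊕ simple T (init x))

derivedKey : ∀ {k c} d → Derivers k c d → Key k c → Key k (d ℕ.+ c)
derivedKey zero    T        x = twist _ T x
derivedKey (suc d) (Ts , T) x = let y = derivedKey d Ts x in y ∷ʳ simple T y

-- The pair (h̃ , ĥ).

Tornado : ℕ → ℕ → ℕ → ℕ → Set
Tornado k r c d = Derivers k c d × Simple k r (d ℕ.+ c)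

allTornado : ∀ k r c d → List (Tornado k r c d)
allTornado k r c d = cartesianProduct (allDerivers k c d) (allSimple k r (d ℕ.+ c))

tornado : ∀ {k r c} d → Tornado k r c d → Key k c → Bits r
tornado d (T̃ , T̂) x = simple T̂ (derivedKey d T̃ x)

-- Q is listed without repetitions, so that a vector of length Q values
-- is an element of 𝓡^Q.

record Selector (k r c : ℕ) : Set where
  field
    queries        : List (Key k c)
    queries-unique : Unique queries
    select         : Key k c → Bits r → Vec (Bits r) (length queries) → Bool
    select-query   : ∀ {q} → q ∈ queries → ∀ v φ → select q v φ ≡ true

open Selector public

selected : ∀ {k r c} → Selector k r c → (Key k c → Bits r) → List (Key k c)
selected f h = filterᵇ
  (λ x → select f x (h x) (Vec.map h (Vec.fromList (queries f))))
  (allKeys _ _)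

-- 0 is a neutral start for the maximum, as probabilities are non-negative
-- and 𝓡^Q is non-empty.

pᶠ : ∀ {k r c} → Selector k r c → Key k c → ℚ
pᶠ {r = r} f x = foldr _⊔_ 0ℚ
  (map (λ φ → Pr (allBits r) (λ v → select f x v φ Bool.≟ true))
       (allVec (allBits r) (length (queries f))))

μ : ∀ {k r c} → Selector k r c → ℚ
μ {k} {r} {c} f = foldr _+_ 0ℚ (map (pᶠ f) (allKeys k c))

EvenOccurrences : ∀ {k b} → List (Key k b) → Set
EvenOccurrences {k} {b} Y =
  ∀ (i : Fin b) (a : Bits k) → 2 ∣ length (filter (λ y → lookup y i ≟ᵇ a) Y)

-- Y′ is a non-empty subset of Y; the multiplicities in the list Y are
-- irrelevant, only membership counts.

Dependency : ∀ {k b} → List (Key k b) → List (Key k b) → Set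
Dependency Y Y′ = Unique Y′ × All (_∈ Y) Y′ × Y′ ≢ [] × EvenOccurrences Y′

LinearlyDependent : ∀ {k b} → List (Key k b) → Set
LinearlyDependent Y = ∃ (Dependency Y)

private

  all-bits? : ∀ {k} {P : Bits k → Set} → Decidable P → Dec (∀ a → P a)
  all-bits? {zero}  P? = map′ (λ { p [] → p }) (λ p → p []) (P? [])
  all-bits? {suc k} P? = map′
    (λ { (p , q) (false ∷ a) → p a ; (p , q) (true ∷ a) → q a })
    (λ p → (p ∘ (false ∷_)) , (p ∘ (true ∷_)))
    (all-bits? (P? ∘ (false ∷_)) ×-dec all-bits? (P? ∘ (true ∷_)))

  []? : ∀ {A : Set} (xs : List A) → Dec (xs ≡ [])
  []? []      = yes refl
  []? (_ ∷ _) = no λ ()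

  dependency? : ∀ {k b} (Y Y′ : List (Key k b)) → Dec (Dependency Y Y′)
  dependency? Y Y′ =
    DecUnique.unique? _≟ᵏ_ Y′ ×-dec
    All.all? (λ y → DecMembership._∈?_ _≟ᵏ_ y Y) Y′ ×-dec
    ¬? ([]? Y′) ×-dec
    Fin.all? (λ i → all-bits? (λ a → 2 ∣? length (filter (λ y → lookup y i ≟ᵇ a) Y′)))

  sublists : ∀ {A : Set} → List A → List (List A)
  sublists []       = [] ∷ []
  sublists (x ∷ xs) = map (x ∷_) (sublists xs) ++ sublists xs

  filter∈sublists : ∀ {A : Set} {P : A → Set} (P? : Decidable P) (xs : List A) → filter P? xs ∈ sublists xs
  filter∈sublists P? [] = here refl
  filter∈sublists P? (x ∷ xs) with P? x
  ... | yes _ = ∈-++⁺ˡ (∈-map⁺ (x ∷_) (filter∈sublists P? xs))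
  ... | no  _ = ∈-++⁺ʳ (map (x ∷_) (sublists xs)) (filter∈sublists P? xs)

  dependency-↭ : ∀ {k b} {Y Y′ Y″ : List (Key k b)} →
    Y″ ↭ Y′ → Unique Y″ → All (_∈ Y) Y″ → Dependency Y Y′ → Dependency Y Y″
  dependency-↭ π u m (_ , _ , ne , ev) =
    u , m , (λ { refl → ne (↭-empty-inv (↭-sym π)) }) ,
    λ i a → subst (2 ∣_) (sym (↭-length (filter-↭ (λ y → lookup y i ≟ᵇ a) π))) (ev i a)

linearlyDependent? : ∀ {k b} → Decidable (LinearlyDependent {k} {b})
linearlyDependent? {k} {b} Y = map′ sound complete (Any.any? (dependency? Y) (sublists Z))
  where
  open DecMembership (_≟ᵏ_ {k} {b}) using (_∈?_)

  Z : List (Key k b)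
  Z = deduplicate _≟ᵏ_ Y

  sound : Any (Dependency Y) (sublists Z) → LinearlyDependent Y
  sound = Any.satisfied

  complete : LinearlyDependent Y → Any (Dependency Y) (sublists Z)
  complete (Y′ , dep@(u , m , _)) =
    lose (filter∈sublists (_∈? Y′) Z)
         (dependency-↭ π u″ (All.tabulate (All.lookup m ∘ back)) dep)
    where
    u″ : Unique (filter (_∈? Y′) Z)
    u″ = Unique.filter⁺ (_∈? Y′) (DecUnique.deduplicate-! _≟ᵏ_ Y)

    back : ∀ {y} → y ∈ filter (_∈? Y′) Z → y ∈ Y′
    back = proj₂ ∘ ∈-filter⁻ (_∈? Y′) {xs = Z}

    forth : ∀ {y} → y ∈ Y′ → y ∈ filter (_∈? Y′) Z
    forth y∈ = ∈-filter⁺ (_∈? Y′) (∈-deduplicate⁺ _≟ᵏ_ (All.lookup m y∈)) y∈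

    π : filter (_∈? Y′) Z ↭ Y′
    π = ∼bag⇒↭ (unique∧set⇒bag u″ u (mk⇔ back forth))

-- h̃(X^{f,h}) for h = ĥ ∘ h̃.

derivedSelected : ∀ {k r c} d → Selector k r c → Tornado k r c d → List (Key k (d ℕ.+ c))
derivedSelected d f t = map (derivedKey d (proj₁ t)) (selected f (tornado d t))

-- (3 / |Σ|)ᵉ

[3/∣Σ∣]^ : ℕ → ℕ → ℚ
[3/∣Σ∣]^ k e = _^_ +-*-rawSemiring ((+ 3 / (2 ℕ.^ k)) ⦃ ℕ.m^n≢0 2 k ⦄) e

{-# OPTIONS --safe #-}
module Submission where

-- The selector picks, independently of h, the n/2 keys with first character a
-- or b, zeros in the middle and last character in the subgroup S of index 4,
-- n = |Σ|.  With probability 1/4 the twist moves both copies of S into the same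
-- coset W, and the twisted keys then form a grid {a, b} × W.
-- By the birthday bound, two elements of W collide with constant probability
-- simultaneously in the tables that read their position in the first two
-- derived characters; this yields four keys in which every position pairs up.
-- Each further derived character takes values v₁, v₂, v₃, v₁ ⊕ v₂ ⊕ v₃ on them
-- and pairs up with probability at least 3(n − 1)/n², since v₁ ⊕ v₂ and v₁ ⊕ v₃
-- are independent and uniform.  Finally (1 − 1/n)ᵈ ≥ 4⁻ᴷ for d ≤ K n.
-- Uniformity is always used by averaging over xor-shifts of a table entry.

open import Data.Bool as Bool using (Bool; true; false; if_then_else_; T)
import Data.Bool.Properties as Bool
open import Data.Fin using (Fin; zero; suc; inject₁; fromℕ)
import Data.Fin.Properties as Fin
import Data.Integer as ℤ
import Data.Integer.Properties as ℤ
open import Data.List using (List; []; _∷_; _++_; length; map; filter; foldr; cartesianProduct; cartesianProductWith)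
open import Data.List.Membership.Propositional using (_∈_; _∉_; find; lose)
open import Data.List.Membership.Propositional.Properties using (∈-map⁺; ∈-map⁻; ∈-filter⁺; ∈-filter⁻; ∈-++⁺ˡ; ∈-++⁺ʳ; ∈-cartesianProduct⁺; ∈-cartesianProduct⁻; ∈-cartesianProductWith⁺)
open import Data.List.Membership.Propositional.Properties.WithK using (unique∧set⇒bag)
import Data.List.Membership.DecPropositional as DecMembership
open import Data.List.Properties using (map-++; map-cong; map-∘; length-map; length-++; length-filter)
open import Data.List.Relation.Binary.BagAndSetEquality using (∼bag⇒↭)
open import Data.List.Relation.Binary.Permutation.Propositional using (_↭_)
open import Data.List.Relation.Binary.Permutation.Propositional.Properties using () renaming (map⁺ to ↭-map⁺)
open import Data.List.Relation.Unary.All as All using (All; []; _∷_)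
open import Data.List.Relation.Unary.All.Properties using (¬Any⇒All¬; All¬⇒¬Any)
open import Data.List.Relation.Unary.AllPairs using ([]; _∷_)
open import Data.List.Relation.Unary.Any as Any using (Any; here; there)
open import Data.List.Relation.Unary.Unique.Propositional using (Unique)
import Data.List.Relation.Unary.Unique.Propositional.Properties as Unique
import Data.List.Relation.Unary.Unique.DecPropositional as DecUnique
open import Data.Nat as ℕ using (ℕ; zero; suc; pred; _+_; _*_; _^_; _∸_; _≤_; z≤n; s≤s; NonZero; >-nonZero⁻¹)
open import Data.Nat.Divisibility using (_∣_; divides)
open import Data.Nat.ListAction using (sum)
open import Data.Nat.ListAction.Properties using (sum-++; sum-↭)
open import Data.Nat.Properties
open import Data.Nat.Tactic.RingSolver using (solve-∀)
open import Data.Product using (∃; ∃₂; _×_; _,_; proj₁; proj₂)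
open import Data.Product.Properties using (≡-dec; ,-injectiveˡ; ,-injectiveʳ)
open import Data.Rational as ℚ using (ℚ; 0ℚ; _/_)
import Data.Rational.Properties as ℚ
open import Data.Rational.Unnormalised as ℚᵘ using (mkℚᵘ)
import Data.Rational.Unnormalised.Properties as ℚᵘ
open import Data.Sum using (_⊎_; inj₁; inj₂)
open import Data.Vec using (Vec; []; _∷_; _∷ʳ_; lookup; replicate; updateAt)
open import Data.Vec.Properties using (∷-injective; ∷-injectiveʳ; init-∷ʳ; last-∷ʳ; zipWith-assoc; zipWith-comm; updateAt-updateAt; updateAt-commutes; updateAt-id-local; lookup∘updateAt; lookup∘updateAt′)
open import Function using (_∘_; mk⇔)
open import Relation.Binary.Definitions using (DecidableEquality)
open import Relation.Binary.PropositionalEquality using (_≡_; _≢_; refl; sym; trans; cong; cong₂; subst; subst₂; module ≡-Reasoning)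
open import Relation.Nullary using (Dec; yes; no; does; ¬_; ¬?; contradiction; _×-dec_; _⊎-dec_)
open import Relation.Unary using (Decidable)
open import Defs

-- Extending a rectangle by one derived character costs a factor of about 3/n, and the exponent d -
-- 2 pays for this in all but two of them, so the first two may cost only a constant. For a fixed
-- pair w, w′ in W a simultaneous collision has probability n⁻², but W has n/4 elements and hence of
-- the order of n² pairs. The collision is asked of table entries and not of derived characters: one
-- coincidence at the position of w serves both prefixes a and b, so a single event settles all four
-- keys. The index 4 of S comes from the budget μ ≤ n/2, which has to pay for two copies of S.
-- Alignment of the copies depends on h̃₀ alone, and the collision bound over the later tables is
-- the same for every h̃₀, so the two probabilities multiply. The estimate (3/n)(1 - 1/n) per
-- further character loses a factor whose powers stay above a constant only while d is at most a
-- multiple of n; this is the origin of `K` and of the dependence of the constant on it.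

private variable
  A B C : Set
  k r c b : ℕ

-- Sums over lists and uniform counting

∑ : List A → (A → ℕ) → ℕ
∑ xs f = sum (map f xs)

∑-cong : ∀ (xs : List A) {f g : A → ℕ} → (∀ x → f x ≡ g x) → ∑ xs f ≡ ∑ xs g
∑-cong xs f≗g = cong sum (map-cong f≗g xs)

∑-mono : ∀ (xs : List A) {f g : A → ℕ} → (∀ x → f x ≤ g x) → ∑ xs f ≤ ∑ xs g
∑-mono []       f≤g = z≤n
∑-mono (x ∷ xs) f≤g = +-mono-≤ (f≤g x) (∑-mono xs f≤g)

∑-distrib-+ : ∀ (xs : List A) {f g : A → ℕ} → ∑ xs (λ x → f x + g x) ≡ ∑ xs f + ∑ xs g
∑-distrib-+ []               = refl
∑-distrib-+ (x ∷ xs) {f} {g} = trans (cong ((f x + g x) +_) (∑-distrib-+ xs))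
  (+-+-interchange (f x) (g x) (∑ xs f) (∑ xs g))
  where
  +-+-interchange : ∀ a b c d → a + b + (c + d) ≡ a + c + (b + d)
  +-+-interchange = solve-∀

∑-distribˡ-* : ∀ (xs : List A) c {f : A → ℕ} → ∑ xs (λ x → c * f x) ≡ c * ∑ xs f
∑-distribˡ-* []       c     = sym (*-zeroʳ c)
∑-distribˡ-* (x ∷ xs) c {f} = trans (cong (c * f x +_) (∑-distribˡ-* xs c))
  (sym (*-distribˡ-+ c (f x) (∑ xs f)))

∑-const : ∀ (xs : List A) c → ∑ xs (λ _ → c) ≡ length xs * c
∑-const []       c = refl
∑-const (x ∷ xs) c = cong (c +_) (∑-const xs c)

∑-swap : ∀ (xs : List A) (ys : List B) (f : A → B → ℕ) →
  ∑ xs (λ x → ∑ ys (f x)) ≡ ∑ ys (λ y → ∑ xs (λ x → f x y))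
∑-swap []       ys f = sym (trans (∑-const ys 0) (*-zeroʳ (length ys)))
∑-swap (x ∷ xs) ys f = trans (cong (∑ ys (f x) +_) (∑-swap xs ys f)) (sym (∑-distrib-+ ys))

∑-++ : ∀ (xs ys : List A) (f : A → ℕ) → ∑ (xs ++ ys) f ≡ ∑ xs f + ∑ ys f
∑-++ xs ys f = trans (cong sum (map-++ f xs ys)) (sum-++ (map f xs) (map f ys))

∑-map : ∀ (g : A → B) xs (f : B → ℕ) → ∑ (map g xs) f ≡ ∑ xs (f ∘ g)
∑-map g xs f = cong sum (sym (map-∘ xs))

∑-cartesianProductWith : ∀ (g : A → B → C) xs ys (f : C → ℕ) →
  ∑ (cartesianProductWith g xs ys) f ≡ ∑ xs (λ x → ∑ ys (λ y → f (g x y)))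
∑-cartesianProductWith g []       ys f = refl
∑-cartesianProductWith g (x ∷ xs) ys f =
  trans (∑-++ (map (g x) ys) _ f)
        (cong₂ _+_ (∑-map (g x) ys f) (∑-cartesianProductWith g xs ys f))

length-as-∑ : ∀ (xs : List A) → length xs ≡ ∑ xs (λ _ → 1)
length-as-∑ xs = sym (trans (∑-const xs 1) (*-identityʳ _))

length-cartesianProductWith : ∀ (g : A → B → C) xs ys →
  length (cartesianProductWith g xs ys) ≡ length xs * length ys
length-cartesianProductWith g xs ys = begin
  length (cartesianProductWith g xs ys)    ≡⟨ length-as-∑ (cartesianProductWith g xs ys) ⟩
  ∑ (cartesianProductWith g xs ys) _       ≡⟨ ∑-cartesianProductWith g xs ys _ ⟩
  ∑ xs (λ _ → ∑ ys (λ _ → 1))              ≡⟨ ∑-const xs _ ⟩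
  length xs * ∑ ys (λ _ → 1)               ≡⟨ cong (length xs *_) (length-as-∑ ys) ⟨
  length xs * length ys                    ∎
  where open ≡-Reasoning

𝟙 : {P : Set} → Dec P → ℕ
𝟙 (yes _) = 1
𝟙 (no _)  = 0

𝟙≤1 : {P : Set} (P? : Dec P) → 𝟙 P? ≤ 1
𝟙≤1 (yes _) = s≤s z≤n
𝟙≤1 (no _)  = z≤n

𝟙-yes : {P : Set} (P? : Dec P) → P → 𝟙 P? ≡ 1
𝟙-yes (yes _) p = refl
𝟙-yes (no ¬p) p = contradiction p ¬p

𝟙-mono : {P Q : Set} (P? : Dec P) (Q? : Dec Q) → (P → Q) → 𝟙 P? ≤ 𝟙 Q?
𝟙-mono (yes p) Q? i = ≤-reflexive (sym (𝟙-yes Q? (i p)))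
𝟙-mono (no _)  Q? i = z≤n

length-filter-as-∑ : {P : A → Set} (P? : Decidable P) (xs : List A) → length (filter P? xs) ≡ ∑ xs (𝟙 ∘ P?)
length-filter-as-∑ P? []       = refl
length-filter-as-∑ P? (x ∷ xs) with P? x
... | yes _ = cong suc (length-filter-as-∑ P? xs)
... | no _  = length-filter-as-∑ P? xs

term≤∑ : ∀ {xs : List A} {f : A → ℕ} {x} → x ∈ xs → f x ≤ ∑ xs f
term≤∑ {f = f} (here refl)        = m≤m+n _ _
term≤∑ {xs = y ∷ _} {f} (there x∈) = ≤-trans (term≤∑ x∈) (m≤n+m _ (f y))

module _ (_≟_ : DecidableEquality A) where

  ∑-𝟙-≟≤1 : ∀ {xs} → Unique xs → ∀ y → ∑ xs (λ x → 𝟙 (x ≟ y)) ≤ 1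
  ∑-𝟙-≟≤1 []         y = z≤n
  ∑-𝟙-≟≤1 {x ∷ xs} (x∉ ∷ u) y with x ≟ y
  ... | no _     = ∑-𝟙-≟≤1 u y
  ... | yes refl = ≤-reflexive (cong suc (∑-none x∉))
    where
    ∑-none : ∀ {zs} → All (x ≢_) zs → ∑ zs (λ z → 𝟙 (z ≟ x)) ≡ 0
    ∑-none []                 = refl
    ∑-none {z ∷ _} (x≢z ∷ ps) with z ≟ x
    ... | yes z≡x = contradiction (sym z≡x) x≢z
    ... | no _    = ∑-none ps

  -- Double counting of the equal pairs: each x has at least one partner in `ys`, and each y at most
  -- one in the duplicate-free `xs`.
  length-unique-⊆ : ∀ {xs ys} → Unique xs → (∀ {x} → x ∈ xs → x ∈ ys) → length xs ≤ length ys
  length-unique-⊆ {xs} {ys} u xs⊆ys = begin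
    length xs                            ≡⟨ length-as-∑ xs ⟩
    ∑ xs (λ _ → 1)                       ≤⟨ below xs xs⊆ys ⟩
    ∑ xs (λ x → ∑ ys (λ y → 𝟙 (x ≟ y)))  ≡⟨ ∑-swap xs ys _ ⟩
    ∑ ys (λ y → ∑ xs (λ x → 𝟙 (x ≟ y)))  ≤⟨ ∑-mono ys (∑-𝟙-≟≤1 u) ⟩
    ∑ ys (λ _ → 1)                       ≡⟨ length-as-∑ ys ⟨
    length ys                            ∎
    where
    open ≤-Reasoning
    below : ∀ zs → (∀ {x} → x ∈ zs → x ∈ ys) → ∑ zs (λ _ → 1) ≤ ∑ zs (λ x → ∑ ys (λ y → 𝟙 (x ≟ y)))
    below []       _ = z≤n
    below (z ∷ zs) i = +-mono-≤
      (≤-trans (≤-reflexive (sym (𝟙-yes (z ≟ z) refl))) (term≤∑ (i (here refl)))) (below zs (i ∘ there))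

-- Enumerated types and averaging over involutions

record Enumeration (A : Set) : Set where
  field
    list     : List A
    unique   : Unique list
    complete : ∀ x → x ∈ list

open Enumeration public

∣_∣ : Enumeration A → ℕ
∣ X ∣ = length (list X)

-- A self-inverse map is a bijection, so it only permutes a duplicate-free complete list.
∑-involution : ∀ (X : Enumeration A) {τ : A → A} → (∀ x → τ (τ x) ≡ x) →
  ∀ (f : A → ℕ) → ∑ (list X) (f ∘ τ) ≡ ∑ (list X) f
∑-involution X {τ} ττ f = trans (sym (∑-map τ (list X) f)) (sum-↭ (↭-map⁺ f τX↭X))
  where
  τ-injective : ∀ {x y} → τ x ≡ τ y → x ≡ y
  τ-injective {x} {y} e = trans (sym (ττ x)) (trans (cong τ e) (ττ y))

  τX↭X : map τ (list X) ↭ list X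
  τX↭X = ∼bag⇒↭ (unique∧set⇒bag (Unique.map⁺ τ-injective (unique X)) (unique X)
    (mk⇔ (λ _ → complete X _)
         (λ _ → subst (_∈ map τ (list X)) (ττ _) (∈-map⁺ τ (complete X _)))))

-- A uniform element of X may be resampled by a random involution τ b.
∑-resample : ∀ (X : Enumeration A) (bs : List B) (τ : B → A → A) → (∀ b x → τ b (τ b x) ≡ x) →
  ∀ (f : A → ℕ) → length bs * ∑ (list X) f ≡ ∑ (list X) (λ x → ∑ bs (λ b → f (τ b x)))
∑-resample X bs τ ττ f = begin
  length bs * ∑ (list X) f                    ≡⟨ ∑-const bs _ ⟨
  ∑ bs (λ _ → ∑ (list X) f)                   ≡⟨ ∑-cong bs (λ b → ∑-involution X (ττ b) f) ⟨
  ∑ bs (λ b → ∑ (list X) (f ∘ τ b))           ≡⟨ ∑-swap bs (list X) _ ⟩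
  ∑ (list X) (λ x → ∑ bs (λ b → f (τ b x)))   ∎
  where open ≡-Reasoning

cartesianProductᵉ : Enumeration A → Enumeration B → Enumeration (A × B)
cartesianProductᵉ X Y = record
  { list     = cartesianProduct (list X) (list Y)
  ; unique   = Unique.cartesianProduct⁺ (unique X) (unique Y)
  ; complete = λ (x , y) → ∈-cartesianProduct⁺ (complete X x) (complete Y y)
  }

𝟙-¬? : {P : Set} (P? : Dec P) → 𝟙 (¬? P?) + 𝟙 P? ≡ 1
𝟙-¬? (yes _) = refl
𝟙-¬? (no _)  = refl

∑-𝟙-none : {P : A → Set} (P? : Decidable P) (xs : List A) → (∀ x → ¬ P x) → ∑ xs (𝟙 ∘ P?) ≡ 0
∑-𝟙-none P? []       none = refl
∑-𝟙-none P? (x ∷ xs) none with P? x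
... | yes p = contradiction p (none x)
... | no _  = ∑-𝟙-none P? xs none

-- Probabilities of at least 1/p and 1/q multiply to at least 1/(p q).
∑-two-stage : ∀ {A B C : Set} (X : List A) (Y : List B) (Z : List C) {P : A → Set} {Q : (A × B) × C → Set}
  (P? : ∀ a → Dec (P a)) (Q? : ∀ t → Dec (Q t)) p q →
  length X ≤ p * ∑ X (𝟙 ∘ P?) →
  (∀ a → P a → length (cartesianProduct Y Z) ≤ q * ∑ (cartesianProduct Y Z) (λ t → 𝟙 (Q? ((a , proj₁ t) , proj₂ t)))) →
  length (cartesianProduct (cartesianProduct X Y) Z) ≤ p * q * ∑ (cartesianProduct (cartesianProduct X Y) Z) (𝟙 ∘ Q?)
∑-two-stage X Y Z P? Q? p q hP hQ = begin
  length (cartesianProduct (cartesianProduct X Y) Z)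
    ≡⟨ length-cartesianProductWith _,_ (cartesianProduct X Y) Z ⟩
  length (cartesianProduct X Y) * length Z
    ≡⟨ cong (_* length Z) (length-cartesianProductWith _,_ X Y) ⟩
  length X * length Y * length Z
    ≡⟨ *-assoc (length X) (length Y) (length Z) ⟩
  length X * (length Y * length Z)
    ≡⟨ cong (length X *_) (length-cartesianProductWith _,_ Y Z) ⟨
  length X * M
    ≤⟨ *-monoˡ-≤ M hP ⟩
  p * ∑ X (𝟙 ∘ P?) * M
    ≡⟨ rearrange p (∑ X (𝟙 ∘ P?)) M ⟩
  p * (M * ∑ X (𝟙 ∘ P?))
    ≡⟨ cong (p *_) (∑-distribˡ-* X M) ⟨
  p * ∑ X (λ a → M * 𝟙 (P? a))
    ≤⟨ *-monoʳ-≤ p (∑-mono X pointwise) ⟩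
  p * ∑ X (λ a → q * inner a)
    ≡⟨ cong (p *_) (∑-distribˡ-* X q) ⟩
  p * (q * ∑ X inner)
    ≡⟨ *-assoc p q (∑ X inner) ⟨
  p * q * ∑ X inner
    ≡⟨ cong (p * q *_) (∑-cong X (λ a → ∑-cartesianProductWith _,_ Y Z _)) ⟩
  p * q * ∑ X (λ a → ∑ Y (λ b → ∑ Z (λ c → 𝟙 (Q? ((a , b) , c)))))
    ≡⟨ cong (p * q *_) (∑-cartesianProductWith _,_ X Y _) ⟨
  p * q * ∑ (cartesianProduct X Y) (λ t → ∑ Z (λ c → 𝟙 (Q? (t , c))))
    ≡⟨ cong (p * q *_) (∑-cartesianProductWith _,_ (cartesianProduct X Y) Z _) ⟨
  p * q * ∑ (cartesianProduct (cartesianProduct X Y) Z) (𝟙 ∘ Q?) ∎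
  where
  open ≤-Reasoning
  M = length (cartesianProduct Y Z)

  inner : _ → ℕ
  inner a = ∑ (cartesianProduct Y Z) (λ t → 𝟙 (Q? ((a , proj₁ t) , proj₂ t)))

  rearrange : ∀ p s M → p * s * M ≡ p * (M * s)
  rearrange = solve-∀

  pointwise : ∀ a → M * 𝟙 (P? a) ≤ q * inner a
  pointwise a with P? a
  ... | no _  = ≤-trans (≤-reflexive (*-zeroʳ M)) z≤n
  ... | yes h = ≤-trans (≤-reflexive (*-identityʳ M)) (hQ a h)

-- Union bound without subtraction: if `Q` has density at most q/(q + 1), then `P`, which covers the
-- rest, has density at least 1/(q + 1).
∑-complement : ∀ {A : Set} (X : List A) {P Q : A → Set} (P? : ∀ x → Dec (P x)) (Q? : ∀ x → Dec (Q x)) q →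
  (∀ x → ¬ Q x → P x) → suc q * ∑ X (𝟙 ∘ Q?) ≤ q * length X → length X ≤ suc q * ∑ X (𝟙 ∘ P?)
∑-complement X P? Q? q cover few = +-cancelʳ-≤ (q * length X) _ _ (begin
  suc q * length X                                  ≡⟨ cong (suc q *_) (length-as-∑ X) ⟩
  suc q * ∑ X (λ _ → 1)                             ≤⟨ *-monoʳ-≤ (suc q) (∑-mono X pointwise) ⟩
  suc q * ∑ X (λ x → 𝟙 (P? x) + 𝟙 (Q? x))           ≡⟨ cong (suc q *_) (∑-distrib-+ X) ⟩
  suc q * (∑ X (𝟙 ∘ P?) + ∑ X (𝟙 ∘ Q?))             ≡⟨ *-distribˡ-+ (suc q) (∑ X (𝟙 ∘ P?)) (∑ X (𝟙 ∘ Q?)) ⟩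
  suc q * ∑ X (𝟙 ∘ P?) + suc q * ∑ X (𝟙 ∘ Q?)       ≤⟨ +-monoʳ-≤ (suc q * ∑ X (𝟙 ∘ P?)) few ⟩
  suc q * ∑ X (𝟙 ∘ P?) + q * length X               ∎)
  where
  open ≤-Reasoning
  pointwise : ∀ x → 1 ≤ 𝟙 (P? x) + 𝟙 (Q? x)
  pointwise x with Q? x
  ... | yes _ = m≤n+m 1 _
  ... | no ¬q = ≤-trans (≤-reflexive (sym (𝟙-yes (P? x) (cover x ¬q)))) (m≤m+n _ 0)

∑-proj₁ : ∀ {A B : Set} (X : List A) (Y : List B) (f : A → ℕ) →
  ∑ (cartesianProduct X Y) (f ∘ proj₁) ≡ length Y * ∑ X f
∑-proj₁ X Y f = begin
  ∑ (cartesianProduct X Y) (f ∘ proj₁)    ≡⟨ ∑-cartesianProductWith _,_ X Y _ ⟩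
  ∑ X (λ x → ∑ Y (λ _ → f x))             ≡⟨ ∑-cong X (λ x → ∑-const Y (f x)) ⟩
  ∑ X (λ x → length Y * f x)              ≡⟨ ∑-distribˡ-* X (length Y) ⟩
  length Y * ∑ X f                        ∎
  where open ≡-Reasoning

-- This lets a bound over pairs of tables be reused for d = 1, where the second table is absent.
∑-proj₁-cancel : ∀ {A B : Set} (X : List A) (Y : List B) q (f : A → ℕ) → .{{NonZero (length Y)}} →
  length (cartesianProduct X Y) ≤ q * ∑ (cartesianProduct X Y) (f ∘ proj₁) → length X ≤ q * ∑ X f
∑-proj₁-cancel X Y q f h = *-cancelʳ-≤ _ _ (length Y) (begin
  length X * length Y                          ≡⟨ length-cartesianProductWith _,_ X Y ⟨
  length (cartesianProduct X Y)                ≤⟨ h ⟩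
  q * ∑ (cartesianProduct X Y) (f ∘ proj₁)     ≡⟨ cong (q *_) (∑-proj₁ X Y f) ⟩
  q * (length Y * ∑ X f)                       ≡⟨ rearrange q (length Y) (∑ X f) ⟩
  q * ∑ X f * length Y                         ∎)
  where
  open ≤-Reasoning
  rearrange : ∀ q y s → q * (y * s) ≡ q * s * y
  rearrange = solve-∀

-- Simple tabulation

⊕-assoc : ∀ (x y z : Bits k) → (x ⊕ y) ⊕ z ≡ x ⊕ (y ⊕ z)
⊕-assoc = zipWith-assoc Bool.xor-assoc

⊕-comm : ∀ (x y : Bits k) → x ⊕ y ≡ y ⊕ x
⊕-comm = zipWith-comm Bool.xor-comm

⊕-cancel : ∀ (x y : Bits k) → x ⊕ (x ⊕ y) ≡ y
⊕-cancel []          []          = refl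
⊕-cancel (false ∷ x) (c ∷ y)     = cong (c ∷_) (⊕-cancel x y)
⊕-cancel (true ∷ x)  (false ∷ y) = cong (false ∷_) (⊕-cancel x y)
⊕-cancel (true ∷ x)  (true ∷ y)  = cong (true ∷_) (⊕-cancel x y)

⊕-cancelʳ : ∀ (x y : Bits k) → (x ⊕ y) ⊕ y ≡ x
⊕-cancelʳ x y = trans (⊕-comm (x ⊕ y) y) (trans (cong (y ⊕_) (⊕-comm x y)) (⊕-cancel y x))

⊕-conj : ∀ (x y : Bits k) → x ⊕ (y ⊕ x) ≡ y
⊕-conj x y = trans (cong (x ⊕_) (⊕-comm y x)) (⊕-cancel x y)

⊕-injectiveˡ : ∀ (x : Bits k) {y z} → x ⊕ y ≡ x ⊕ z → y ≡ z
⊕-injectiveˡ x {y} {z} e = trans (sym (⊕-cancel x y)) (trans (cong (x ⊕_) e) (⊕-cancel x z))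

⊕-injectiveʳ : ∀ (x : Bits k) {y z} → y ⊕ x ≡ z ⊕ x → y ≡ z
⊕-injectiveʳ x {y} {z} e = ⊕-injectiveˡ x (trans (⊕-comm x y) (trans e (⊕-comm z x)))

⊕-swap : ∀ (x y z : Bits k) → x ⊕ (y ⊕ z) ≡ y ⊕ (x ⊕ z)
⊕-swap x y z = trans (sym (⊕-assoc x y z)) (trans (cong (_⊕ z) (⊕-comm x y)) (⊕-assoc y x z))

⊕-interchange : ∀ (w x y z : Bits k) → (w ⊕ x) ⊕ (y ⊕ z) ≡ (w ⊕ y) ⊕ (x ⊕ z)
⊕-interchange w x y z = trans (⊕-assoc w x (y ⊕ z))
  (trans (cong (w ⊕_) (⊕-swap x y z)) (sym (⊕-assoc w y (x ⊕ z))))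

index-injective : ∀ (x y : Bits k) → index x ≡ index y → x ≡ y
index-injective []      []      _ = refl
index-injective (c ∷ x) (d ∷ y) e =
  cong₂ _∷_ (bit c d (proj₁ split)) (index-injective x y (proj₂ split))
  where
  split = Fin.combine-injective {2} (if c then suc zero else zero) (index x)
    (if d then suc zero else zero) (index y) e

  bit : ∀ c d → _≡_ {A = Fin 2} (if c then suc zero else zero) (if d then suc zero else zero) → c ≡ d
  bit false false _ = refl
  bit true  true  _ = refl

boolᵉ : Enumeration Bool
boolᵉ = record
  { list     = false ∷ true ∷ []
  ; unique   = ((λ ()) ∷ []) ∷ [] ∷ []
  ; complete = λ { false → here refl ; true → there (here refl) }
  }

vecᵉ : Enumeration A → ∀ n → Enumeration (Vec A n)
vecᵉ X n = record { list = allVec (list X) n ; unique = allVec-unique n ; complete = ∈-allVec }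
  where
  allVec-unique : ∀ n → Unique (allVec (list X) n)
  allVec-unique zero    = [] ∷ []
  allVec-unique (suc n) = Unique.cartesianProductWith⁺ _∷_ ∷-injective (unique X) (allVec-unique n)

  ∈-allVec : ∀ {n} (v : Vec _ n) → v ∈ allVec (list X) n
  ∈-allVec []      = here refl
  ∈-allVec (x ∷ v) = ∈-cartesianProductWith⁺ _∷_ (complete X x) (∈-allVec v)

bitsᵉ : ∀ k → Enumeration (Bits k)
bitsᵉ = vecᵉ boolᵉ

keysᵉ : ∀ k b → Enumeration (Key k b)
keysᵉ k = vecᵉ (bitsᵉ k)

simpleᵉ : ∀ k r b → Enumeration (Simple k r b)
simpleᵉ k r = vecᵉ (vecᵉ (bitsᵉ r) (2 ^ k))

∣allBits∣ : ∀ k → length (allBits k) ≡ 2 ^ k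
∣allBits∣ zero    = refl
∣allBits∣ (suc k) = trans (length-cartesianProductWith _∷_ (false ∷ true ∷ []) (allBits k))
  (cong (2 *_) (∣allBits∣ k))

-- The resampling move: for uniform `p` one table entry becomes uniform while all others stay fixed,
-- and as an xor with a constant the move undoes itself.
bump : Fin b → Bits k → Bits r → Simple k r b → Simple k r b
bump i a p T = updateAt T i (λ t → updateAt t (index a) (p ⊕_))

bump-involutive : ∀ (i : Fin b) (a : Bits k) p (T : Simple k r b) → bump i a p (bump i a p T) ≡ T
bump-involutive i a p T = trans (updateAt-updateAt i T) (updateAt-id-local i T
  (trans (updateAt-updateAt (index a) (lookup T i))
         (updateAt-id-local (index a) (lookup T i) (⊕-cancel p (lookup T i [ a ])))))

lookup-bump-hit : ∀ (i : Fin b) (a : Bits k) p (T : Simple k r b) →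
  lookup (bump i a p T) i [ a ] ≡ p ⊕ lookup T i [ a ]
lookup-bump-hit i a p T =
  trans (cong (λ t → t [ a ]) (lookup∘updateAt i T)) (lookup∘updateAt (index a) (lookup T i))

lookup-bump-miss : ∀ (i : Fin b) {a a′ : Bits k} p (T : Simple k r b) → a′ ≢ a →
  lookup (bump i a p T) i [ a′ ] ≡ lookup T i [ a′ ]
lookup-bump-miss i {a} {a′} p T a′≢a =
  trans (cong (λ t → t [ a′ ]) (lookup∘updateAt i T))
        (lookup∘updateAt′ (index a′) (index a) (a′≢a ∘ index-injective a′ a) (lookup T i))

simple-bump-hit : ∀ (i : Fin b) {a : Bits k} p (T : Simple k r b) (y : Key k b) → lookup y i ≡ a →
  simple (bump i a p T) y ≡ p ⊕ simple T y
simple-bump-hit zero    {a} p (t ∷ T) (.a ∷ y) refl =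
  trans (cong (_⊕ simple T y) (lookup∘updateAt (index a) t)) (⊕-assoc p (t [ a ]) (simple T y))
simple-bump-hit (suc i) {a} p (t ∷ T) (c ∷ y)  e =
  trans (cong (t [ c ] ⊕_) (simple-bump-hit i p T y e)) (⊕-swap (t [ c ]) p (simple T y))

simple-bump-miss : ∀ (i : Fin b) {a : Bits k} p (T : Simple k r b) (y : Key k b) → lookup y i ≢ a →
  simple (bump i a p T) y ≡ simple T y
simple-bump-miss zero    {a} p (t ∷ T) (c ∷ y) ne =
  cong (_⊕ simple T y) (lookup∘updateAt′ (index c) (index a) (ne ∘ index-injective c a) t)
simple-bump-miss (suc i) {a} p (t ∷ T) (c ∷ y) ne =
  cong (t [ c ] ⊕_) (simple-bump-miss i p T y ne)

lookup-∷ʳ-inject₁ : ∀ (xs : Vec A b) x i → lookup (xs ∷ʳ x) (inject₁ i) ≡ lookup xs i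
lookup-∷ʳ-inject₁ (y ∷ xs) x zero    = refl
lookup-∷ʳ-inject₁ (y ∷ xs) x (suc i) = lookup-∷ʳ-inject₁ xs x i

lookup-∷ʳ-fromℕ : ∀ (xs : Vec A b) x → lookup (xs ∷ʳ x) (fromℕ b) ≡ x
lookup-∷ʳ-fromℕ []       x = refl
lookup-∷ʳ-fromℕ (y ∷ xs) x = lookup-∷ʳ-fromℕ xs x

-- Rectangles of keys

-- The three perfect matchings of four keys. For four characters this amounts to even
-- multiplicities, in a form suited to case analysis.
Paired : A → A → A → A → Set
Paired x₁ x₂ x₃ x₄ = (x₁ ≡ x₂ × x₃ ≡ x₄) ⊎ (x₁ ≡ x₃ × x₂ ≡ x₄) ⊎ (x₂ ≡ x₃ × x₁ ≡ x₄)

AllPaired : (y₁ y₂ y₃ y₄ : Key k b) → Set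
AllPaired y₁ y₂ y₃ y₄ = ∀ i → Paired (lookup y₁ i) (lookup y₂ i) (lookup y₃ i) (lookup y₄ i)

AllPaired-∷ʳ : ∀ (y₁ y₂ y₃ y₄ : Key k b) {v₁ v₂ v₃ v₄} → AllPaired y₁ y₂ y₃ y₄ → Paired v₁ v₂ v₃ v₄ →
  AllPaired (y₁ ∷ʳ v₁) (y₂ ∷ʳ v₂) (y₃ ∷ʳ v₃) (y₄ ∷ʳ v₄)
AllPaired-∷ʳ []       []       []       []       ps p zero    = p
AllPaired-∷ʳ (_ ∷ _)  (_ ∷ _)  (_ ∷ _)  (_ ∷ _)  ps p zero    = ps zero
AllPaired-∷ʳ (_ ∷ y₁) (_ ∷ y₂) (_ ∷ y₃) (_ ∷ y₄) ps p (suc i) = AllPaired-∷ʳ y₁ y₂ y₃ y₄ (ps ∘ suc) p i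

-- Equal characters at a position read the same table entry, so the four entries cancel in pairs and
-- the four hash values xor to zero.
simple-AllPaired : ∀ (T : Simple k r b) (y₁ y₂ y₃ y₄ : Key k b) → AllPaired y₁ y₂ y₃ y₄ →
  simple T y₄ ≡ simple T y₁ ⊕ (simple T y₂ ⊕ simple T y₃)
simple-AllPaired []      []       []       []       []       _  = sym (⊕-cancel 0ᵇ 0ᵇ)
  where 0ᵇ = replicate _ false
simple-AllPaired {k} (t ∷ T) (a ∷ y₁) (b ∷ y₂) (c ∷ y₃) (d ∷ y₄) ps = begin
  t [ d ] ⊕ simple T y₄
    ≡⟨ cong₂ _⊕_ (char (ps zero)) (simple-AllPaired T y₁ y₂ y₃ y₄ (ps ∘ suc)) ⟩
  (t [ a ] ⊕ (t [ b ] ⊕ t [ c ])) ⊕ (simple T y₁ ⊕ (simple T y₂ ⊕ simple T y₃))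
    ≡⟨ ⊕-interchange (t [ a ]) (t [ b ] ⊕ t [ c ]) (simple T y₁) (simple T y₂ ⊕ simple T y₃) ⟩
  (t [ a ] ⊕ simple T y₁) ⊕ ((t [ b ] ⊕ t [ c ]) ⊕ (simple T y₂ ⊕ simple T y₃))
    ≡⟨ cong ((t [ a ] ⊕ simple T y₁) ⊕_) (⊕-interchange (t [ b ]) (t [ c ]) (simple T y₂) (simple T y₃)) ⟩
  (t [ a ] ⊕ simple T y₁) ⊕ ((t [ b ] ⊕ simple T y₂) ⊕ (t [ c ] ⊕ simple T y₃)) ∎
  where
  open ≡-Reasoning
  char : ∀ {a b c d : Bits k} → Paired a b c d → t [ d ] ≡ t [ a ] ⊕ (t [ b ] ⊕ t [ c ])
  char {a} {b} {c} (inj₁ (refl , refl))        = sym (⊕-cancel (t [ a ]) (t [ c ]))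
  char {a} {b} {c} (inj₂ (inj₁ (refl , refl))) = sym (⊕-conj (t [ a ]) (t [ b ]))
  char {a} {b} {c} (inj₂ (inj₂ (refl , refl))) =
    sym (trans (⊕-swap (t [ a ]) (t [ b ]) (t [ b ])) (⊕-conj (t [ b ]) (t [ a ])))

-- Four keys forming a rectangle: y₁, y₃ | y₂, y₄ are separated by one
-- position and y₁, y₂ | y₃, y₄ by another.
Rect : (y₁ y₂ y₃ y₄ : Key k b) → Set
Rect y₁ y₂ y₃ y₄ =
  (∃ λ i → lookup y₁ i ≡ lookup y₃ i × lookup y₁ i ≢ lookup y₂ i) ×
  (∃ λ j → lookup y₁ j ≡ lookup y₂ j × lookup y₁ j ≢ lookup y₃ j) ×
  AllPaired y₁ y₂ y₃ y₄

rect? : ∀ (y₁ y₂ y₃ y₄ : Key k b) → Dec (Rect y₁ y₂ y₃ y₄)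
rect? y₁ y₂ y₃ y₄ =
  Fin.any? (λ i → (lookup y₁ i ≟ᵇ lookup y₃ i) ×-dec ¬? (lookup y₁ i ≟ᵇ lookup y₂ i)) ×-dec
  Fin.any? (λ j → (lookup y₁ j ≟ᵇ lookup y₂ j) ×-dec ¬? (lookup y₁ j ≟ᵇ lookup y₃ j)) ×-dec
  Fin.all? (λ i → paired? (lookup y₁ i) (lookup y₂ i) (lookup y₃ i) (lookup y₄ i))
  where
  paired? : ∀ (x₁ x₂ x₃ x₄ : Bits _) → Dec (Paired x₁ x₂ x₃ x₄)
  paired? x₁ x₂ x₃ x₄ =
    ((x₁ ≟ᵇ x₂) ×-dec (x₃ ≟ᵇ x₄)) ⊎-dec ((x₁ ≟ᵇ x₃) ×-dec (x₂ ≟ᵇ x₄)) ⊎-dec ((x₂ ≟ᵇ x₃) ×-dec (x₁ ≟ᵇ x₄))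

separated-∷ʳ : ∀ (x y z : Key k b) {u v w} →
  (∃ λ i → lookup x i ≡ lookup y i × lookup x i ≢ lookup z i) →
  ∃ λ i → lookup (x ∷ʳ u) i ≡ lookup (y ∷ʳ v) i × lookup (x ∷ʳ u) i ≢ lookup (z ∷ʳ w) i
separated-∷ʳ x y z {u} {v} {w} (i , e , ne) = inject₁ i ,
  trans (lookup-∷ʳ-inject₁ x u i) (trans e (sym (lookup-∷ʳ-inject₁ y v i))) ,
  λ e′ → ne (trans (sym (lookup-∷ʳ-inject₁ x u i)) (trans e′ (lookup-∷ʳ-inject₁ z w i)))

Rect-∷ʳ : ∀ (y₁ y₂ y₃ y₄ : Key k b) {v₁ v₂ v₃ v₄} → Rect y₁ y₂ y₃ y₄ → Paired v₁ v₂ v₃ v₄ →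
  Rect (y₁ ∷ʳ v₁) (y₂ ∷ʳ v₂) (y₃ ∷ʳ v₃) (y₄ ∷ʳ v₄)
Rect-∷ʳ y₁ y₂ y₃ y₄ (s , s′ , ps) p =
  separated-∷ʳ y₁ y₃ y₂ s , separated-∷ʳ y₁ y₂ y₃ s′ , AllPaired-∷ʳ y₁ y₂ y₃ y₄ ps p

-- The fourth value is the xor of the other three, so one coincidence
-- among them pairs up all four.
Rect-extend : ∀ (T : Simple k k b) (y₁ y₂ y₃ y₄ : Key k b) → Rect y₁ y₂ y₃ y₄ →
  (simple T y₁ ≡ simple T y₂) ⊎ (simple T y₁ ≡ simple T y₃) ⊎ (simple T y₂ ≡ simple T y₃) →
  Rect (y₁ ∷ʳ simple T y₁) (y₂ ∷ʳ simple T y₂) (y₃ ∷ʳ simple T y₃) (y₄ ∷ʳ simple T y₄)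
Rect-extend {k} T y₁ y₂ y₃ y₄ R@(_ , _ , ps) e = Rect-∷ʳ y₁ y₂ y₃ y₄ R
  (paired (simple T y₁) (simple T y₂) (simple T y₃) (simple-AllPaired T y₁ y₂ y₃ y₄ ps) e)
  where
  paired : ∀ (v₁ v₂ v₃ : Bits k) {v₄} → v₄ ≡ v₁ ⊕ (v₂ ⊕ v₃) → (v₁ ≡ v₂) ⊎ (v₁ ≡ v₃) ⊎ (v₂ ≡ v₃) → Paired v₁ v₂ v₃ v₄
  paired v₁ v₂ v₃ refl (inj₁ refl)        = inj₁ (refl , sym (⊕-cancel v₁ v₃))
  paired v₁ v₂ v₃ refl (inj₂ (inj₁ refl)) = inj₂ (inj₁ (refl , sym (⊕-conj v₁ v₂)))
  paired v₁ v₂ v₃ refl (inj₂ (inj₂ refl)) = inj₂ (inj₂ (refl , sym (trans (⊕-swap v₁ v₂ v₂) (⊕-conj v₂ v₁))))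

-- For p = `p₀` the first two values agree and all n choices of q work; for every other p at least
-- two do. This gives n + 2(n - 1) = 3n - 2 pairs, weakened to 3(n - 1) so that powers factor into
-- 3ᵉ and (n - 1)ᵉ.
count-coincidences : 2 ≤ 2 ^ k → ∀ (v₁ v₂ v₃ : Bits k) {P : Bits k × Bits k → Set} (P? : ∀ x → Dec (P x)) →
  (∀ p q → (v₁ ≡ p ⊕ v₂) ⊎ (v₁ ≡ q ⊕ v₃) ⊎ (p ⊕ v₂ ≡ q ⊕ v₃) → P (p , q)) →
  3 * (2 ^ k ∸ 1) ≤ ∑ (cartesianProduct (allBits k) (allBits k)) (𝟙 ∘ P?)
count-coincidences {k} 2≤n v₁ v₂ v₃ {P} P? implies = begin
  3 * (2 ^ k ∸ 1)                                         ≤⟨ arith (2 ^ k) 2≤n ⟩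
  2 ^ k * 2 + (2 ^ k ∸ 2)                                 ≡⟨ cong (λ m → m * 2 + (2 ^ k ∸ 2)) (∣allBits∣ k) ⟨
  length Σ * 2 + (2 ^ k ∸ 2)                              ≤⟨ +-mono-≤ (≤-reflexive (sym (∑-const Σ 2))) special ⟩
  ∑ Σ (λ _ → 2) + ∑ Σ (λ p → (2 ^ k ∸ 2) * 𝟙 (p ≟ᵇ p₀))  ≡⟨ ∑-distrib-+ Σ ⟨
  ∑ Σ (λ p → 2 + (2 ^ k ∸ 2) * 𝟙 (p ≟ᵇ p₀))              ≤⟨ ∑-mono Σ inner ⟩
  ∑ Σ (λ p → ∑ Σ (λ q → 𝟙 (P? (p , q))))                 ≡⟨ ∑-cartesianProductWith _,_ Σ Σ _ ⟨
  ∑ (cartesianProduct Σ Σ) (𝟙 ∘ P?)                       ∎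
  where
  open ≤-Reasoning
  Σ  = allBits k
  p₀ = v₁ ⊕ v₂

  arith : ∀ n → 2 ≤ n → 3 * (n ∸ 1) ≤ n * 2 + (n ∸ 2)
  arith 1 (s≤s ())
  arith (suc (suc m)) _ = subst (3 * suc m ≤_) (lemma m) (n≤1+n (3 * suc m))
    where
    lemma : ∀ m → 1 + 3 * (1 + m) ≡ (2 + m) * 2 + m
    lemma = solve-∀

  special : 2 ^ k ∸ 2 ≤ ∑ Σ (λ p → (2 ^ k ∸ 2) * 𝟙 (p ≟ᵇ p₀))
  special = begin
    2 ^ k ∸ 2                                ≡⟨ *-identityʳ _ ⟨
    (2 ^ k ∸ 2) * 1                          ≡⟨ cong ((2 ^ k ∸ 2) *_) (𝟙-yes (p₀ ≟ᵇ p₀) refl) ⟨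
    (2 ^ k ∸ 2) * 𝟙 (p₀ ≟ᵇ p₀)               ≤⟨ term≤∑ (complete (bitsᵉ k) p₀) ⟩
    ∑ Σ (λ p → (2 ^ k ∸ 2) * 𝟙 (p ≟ᵇ p₀))    ∎

  two : ∀ p → p ≢ p₀ → 2 ≤ ∑ Σ (λ q → 𝟙 (P? (p , q)))
  two p p≢p₀ = subst (2 ≤_) (length-filter-as-∑ (λ q → P? (p , q)) Σ)
    (length-unique-⊆ _≟ᵇ_ {q₁ ∷ q₂ ∷ []} ((q₁≢q₂ ∷ []) ∷ [] ∷ []) member)
    where
    -- `q₁` makes the third value equal the first, `q₂` makes it equal the second. They coincide
    -- only when those two agree already, that is for p = `p₀`.
    q₁ = v₁ ⊕ v₃
    q₂ = (p ⊕ v₂) ⊕ v₃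

    q₁≢q₂ : q₁ ≢ q₂
    q₁≢q₂ e = p≢p₀ (⊕-injectiveʳ v₂ (trans (sym (⊕-injectiveʳ v₃ e)) (sym (⊕-cancelʳ v₁ v₂))))

    member : ∀ {q} → q ∈ q₁ ∷ q₂ ∷ [] → q ∈ filter (λ q → P? (p , q)) Σ
    member (here refl)         = ∈-filter⁺ (λ q → P? (p , q)) (complete (bitsᵉ k) _)
      (implies p q₁ (inj₂ (inj₁ (sym (⊕-cancelʳ v₁ v₃)))))
    member (there (here refl)) = ∈-filter⁺ (λ q → P? (p , q)) (complete (bitsᵉ k) _)
      (implies p q₂ (inj₂ (inj₂ (sym (⊕-cancelʳ (p ⊕ v₂) v₃)))))

  inner : ∀ p → 2 + (2 ^ k ∸ 2) * 𝟙 (p ≟ᵇ p₀) ≤ ∑ Σ (λ q → 𝟙 (P? (p , q)))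
  inner p with p ≟ᵇ p₀
  ... | no p≢p₀  = ≤-trans (≤-reflexive (cong (2 +_) (*-zeroʳ (2 ^ k ∸ 2)))) (two p p≢p₀)
  ... | yes refl = begin
    2 + (2 ^ k ∸ 2) * 1              ≡⟨ cong (2 +_) (*-identityʳ _) ⟩
    2 + (2 ^ k ∸ 2)                  ≡⟨ m+[n∸m]≡n 2≤n ⟩
    2 ^ k                            ≡⟨ ∣allBits∣ k ⟨
    length Σ                         ≡⟨ length-as-∑ Σ ⟩
    ∑ Σ (λ _ → 1)                    ≤⟨ ∑-mono Σ (λ q → ≤-reflexive (sym (𝟙-yes (P? (p₀ , q))
                                          (implies p₀ q (inj₁ (sym (⊕-cancelʳ v₁ v₂))))))) ⟩
    ∑ Σ (λ q → 𝟙 (P? (p₀ , q)))      ∎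

∣Σ²∣ : ∀ k → length (cartesianProduct (allBits k) (allBits k)) ≡ 2 ^ k * 2 ^ k
∣Σ²∣ k = trans (length-cartesianProductWith _,_ (allBits k) (allBits k)) (cong₂ _*_ (∣allBits∣ k) (∣allBits∣ k))

-- The separating positions provide two free parameters. Bumping the entry that y₂ reads at `i`
-- moves its value but not those of y₁ and y₃; bumping the entry that y₃ reads at `j` moves its
-- value but not those of y₁ and y₂. So the second and third values are shifted independently while
-- the first stays put.
Rect-step : 2 ≤ 2 ^ k → ∀ (y₁ y₂ y₃ y₄ : Key k b) → Rect y₁ y₂ y₃ y₄ →
  {P : Simple k k b → Set} (P? : ∀ T → Dec (P T)) →
  (∀ T → Rect (y₁ ∷ʳ simple T y₁) (y₂ ∷ʳ simple T y₂) (y₃ ∷ʳ simple T y₃) (y₄ ∷ʳ simple T y₄) → P T) →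
  length (allSimple k k b) * (3 * (2 ^ k ∸ 1)) ≤ 2 ^ k * 2 ^ k * ∑ (allSimple k k b) (𝟙 ∘ P?)
Rect-step {k} {b} 2≤n y₁ y₂ y₃ y₄ R@((i , i₁₃ , i₁₂) , (j , j₁₂ , j₁₃) , _) {P} P? implies = begin
  length X * (3 * (2 ^ k ∸ 1))                     ≡⟨ ∑-const X _ ⟨
  ∑ X (λ _ → 3 * (2 ^ k ∸ 1))                      ≤⟨ ∑-mono X (λ T → count-coincidences 2≤n
                                                        (simple T y₁) (simple T y₂) (simple T y₃)
                                                        (λ β → P? (τ β T)) (coincide T)) ⟩
  ∑ X (λ T → ∑ Σ² (λ β → 𝟙 (P? (τ β T))))          ≡⟨ ∑-resample (simpleᵉ k k b) Σ² τ τ-involutive _ ⟨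
  length Σ² * ∑ X (𝟙 ∘ P?)                         ≡⟨ cong (_* ∑ X (𝟙 ∘ P?)) (∣Σ²∣ k) ⟩
  2 ^ k * 2 ^ k * ∑ X (𝟙 ∘ P?)                     ∎
  where
  open ≤-Reasoning
  X  = allSimple k k b
  Σ² = cartesianProduct (allBits k) (allBits k)
  a₂ = lookup y₂ i
  a₃ = lookup y₃ j

  i≢j : i ≢ j
  i≢j refl = i₁₂ j₁₂

  τ : Bits k × Bits k → Simple k k b → Simple k k b
  τ (p , q) T = bump i a₂ p (bump j a₃ q T)

  τ-involutive : ∀ β T → τ β (τ β T) ≡ T
  τ-involutive (p , q) T =
    trans (cong (bump i a₂ p) (updateAt-commutes j i (i≢j ∘ sym) (bump j a₃ q T)))
          (trans (bump-involutive i a₂ p (bump j a₃ q (bump j a₃ q T))) (bump-involutive j a₃ q T))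

  coincide : ∀ (T : Simple k k b) p q →
    (simple T y₁ ≡ p ⊕ simple T y₂) ⊎ (simple T y₁ ≡ q ⊕ simple T y₃) ⊎ (p ⊕ simple T y₂ ≡ q ⊕ simple T y₃) →
    P (τ (p , q) T)
  coincide T p q e = implies (τ (p , q) T) (Rect-extend (τ (p , q) T) y₁ y₂ y₃ y₄ R (transport e))
    where
    T′ = bump j a₃ q T
    e₁ : simple (τ (p , q) T) y₁ ≡ simple T y₁
    e₁ = trans (simple-bump-miss i p T′ y₁ i₁₂) (simple-bump-miss j q T y₁ j₁₃)
    e₂ : simple (τ (p , q) T) y₂ ≡ p ⊕ simple T y₂
    e₂ = trans (simple-bump-hit i p T′ y₂ refl) (cong (p ⊕_) (simple-bump-miss j q T y₂ (j₁₃ ∘ trans j₁₂)))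
    e₃ : simple (τ (p , q) T) y₃ ≡ q ⊕ simple T y₃
    e₃ = trans (simple-bump-miss i p T′ y₃ (i₁₂ ∘ trans i₁₃)) (simple-bump-hit j q T y₃ refl)
    transport : (simple T y₁ ≡ p ⊕ simple T y₂) ⊎ (simple T y₁ ≡ q ⊕ simple T y₃) ⊎ (p ⊕ simple T y₂ ≡ q ⊕ simple T y₃) →
      (simple (τ (p , q) T) y₁ ≡ simple (τ (p , q) T) y₂) ⊎ (simple (τ (p , q) T) y₁ ≡ simple (τ (p , q) T) y₃) ⊎
      (simple (τ (p , q) T) y₂ ≡ simple (τ (p , q) T) y₃)
    transport (inj₁ e)        = inj₁ (trans e₁ (trans e (sym e₂)))
    transport (inj₂ (inj₁ e)) = inj₂ (inj₁ (trans e₁ (trans e (sym e₃))))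
    transport (inj₂ (inj₂ e)) = inj₂ (inj₂ (trans e₂ (trans e (sym e₃))))

-- From rectangles to linear dependencies

module _ (y₁ y₂ y₃ y₄ : Key k b) (R : Rect y₁ y₂ y₃ y₄) where

  private
    i = proj₁ (proj₁ R)
    i₁₃ = proj₁ (proj₂ (proj₁ R))
    i₁₂ = proj₂ (proj₂ (proj₁ R))
    j = proj₁ (proj₁ (proj₂ R))
    j₁₂ = proj₁ (proj₂ (proj₁ (proj₂ R)))
    j₁₃ = proj₂ (proj₂ (proj₁ (proj₂ R)))
    paired = proj₂ (proj₂ R)

    -- Two of the three matchings would equate the characters of y₁ and y₂ at the position that
    -- separates them; only one remains.
    i₂₄ : lookup y₂ i ≡ lookup y₄ i
    i₂₄ with paired i
    ... | inj₁ (e , _)        = contradiction e i₁₂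
    ... | inj₂ (inj₁ (_ , e)) = e
    ... | inj₂ (inj₂ (e , _)) = contradiction (trans i₁₃ (sym e)) i₁₂

    j₃₄ : lookup y₃ j ≡ lookup y₄ j
    j₃₄ with paired j
    ... | inj₁ (_ , e)        = e
    ... | inj₂ (inj₁ (e , _)) = contradiction e j₁₃
    ... | inj₂ (inj₂ (e , _)) = contradiction (trans j₁₂ e) j₁₃

  Rect⇒Unique : Unique (y₁ ∷ y₂ ∷ y₃ ∷ y₄ ∷ [])
  Rect⇒Unique =
    ((λ { refl → i₁₂ refl }) ∷ (λ { refl → j₁₃ refl }) ∷ (λ { refl → i₁₂ (sym i₂₄) }) ∷ []) ∷
    ((λ { refl → i₁₂ i₁₃ }) ∷ (λ { refl → j₁₃ (trans j₁₂ (sym j₃₄)) }) ∷ []) ∷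
    ((λ { refl → i₁₂ (trans i₁₃ (sym i₂₄)) }) ∷ []) ∷ [] ∷ []

  Rect⇒EvenOccurrences : EvenOccurrences (y₁ ∷ y₂ ∷ y₃ ∷ y₄ ∷ [])
  Rect⇒EvenOccurrences i a = subst (2 ∣_) (sym (length-filter-as-∑ (λ y → lookup y i ≟ᵇ a) (y₁ ∷ y₂ ∷ y₃ ∷ y₄ ∷ [])))
    (even (paired i))
    where
    even : ∀ {x₁ x₂ x₃ x₄} → Paired x₁ x₂ x₃ x₄ →
      2 ∣ 𝟙 (x₁ ≟ᵇ a) + (𝟙 (x₂ ≟ᵇ a) + (𝟙 (x₃ ≟ᵇ a) + (𝟙 (x₄ ≟ᵇ a) + 0)))
    even {x₁} {x₂} {x₃} (inj₁ (refl , refl))        = divides (𝟙 (x₁ ≟ᵇ a) + 𝟙 (x₃ ≟ᵇ a)) (e (𝟙 (x₁ ≟ᵇ a)) (𝟙 (x₃ ≟ᵇ a)))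
      where
      e : ∀ u v → u + (u + (v + (v + 0))) ≡ (u + v) * 2
      e = solve-∀
    even {x₁} {x₂} {x₃} (inj₂ (inj₁ (refl , refl))) = divides (𝟙 (x₁ ≟ᵇ a) + 𝟙 (x₂ ≟ᵇ a)) (e (𝟙 (x₁ ≟ᵇ a)) (𝟙 (x₂ ≟ᵇ a)))
      where
      e : ∀ u v → u + (v + (u + (v + 0))) ≡ (u + v) * 2
      e = solve-∀
    even {x₁} {x₂} {x₃} (inj₂ (inj₂ (refl , refl))) = divides (𝟙 (x₁ ≟ᵇ a) + 𝟙 (x₂ ≟ᵇ a)) (e (𝟙 (x₁ ≟ᵇ a)) (𝟙 (x₂ ≟ᵇ a)))
      where
      e : ∀ u v → u + (v + (v + (u + 0))) ≡ (u + v) * 2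
      e = solve-∀

-- The birthday bound

-- The number m(m - 1)/2 of pairs, in the recursive form that the birthday induction produces.
tri : ℕ → ℕ
tri zero    = 0
tri (suc m) = m + tri m

2*tri : ∀ m → 2 * tri m + m ≡ m * m
2*tri zero    = refl
2*tri (suc m) = trans (lemma m (tri m)) (trans (cong (λ z → z + (m + m + 1)) (2*tri m)) (square m))
  where
  lemma : ∀ m t → 2 * (m + t) + (1 + m) ≡ 2 * t + m + (m + m + 1)
  lemma = solve-∀
  square : ∀ m → m * m + (m + m + 1) ≡ (1 + m) * (1 + m)
  square = solve-∀

∃-collision : DecidableEquality B → ∀ (g : A → B) {xs} → Unique xs → ¬ Unique (map g xs) →
  ∃₂ λ x x′ → x ∈ xs × x′ ∈ xs × x ≢ x′ × g x ≡ g x′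
∃-collision _≟_ g []           ¬u = contradiction [] ¬u
∃-collision _≟_ g {x ∷ xs} (x∉ ∷ u) ¬u with DecMembership._∈?_ _≟_ (g x) (map g xs)
... | yes gx∈ with x′ , x′∈ , e ← ∈-map⁻ g gx∈ = x , x′ , here refl , there x′∈ , All.lookup x∉ x′∈ , e
... | no gx∉  with x₁ , x₂ , x₁∈ , x₂∈ , ne , e ← ∃-collision _≟_ g u (λ u′ → ¬u (¬Any⇒All¬ _ gx∉ ∷ u′)) =
  x₁ , x₂ , there x₁∈ , there x₂∈ , ne , e

module Birthday {k b b′ : ℕ} (i : Fin b) (i′ : Fin b′) where

  Σ² : List (Bits k × Bits k)
  Σ² = cartesianProduct (allBits k) (allBits k)

  tables : Enumeration (Simple k k b × Simple k k b′)
  tables = cartesianProductᵉ (simpleᵉ k k b) (simpleᵉ k k b′)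

  _≟²_ : DecidableEquality (Bits k × Bits k)
  _≟²_ = ≡-dec _≟ᵇ_ _≟ᵇ_

  -- Both tables must collide on the same pair of characters, so they are treated as one table with
  -- n² possible values.
  entries : Simple k k b × Simple k k b′ → Bits k → Bits k × Bits k
  entries (T , U) w = lookup T i [ w ] , lookup U i′ [ w ]

  Distinct : List (Bits k) → Simple k k b × Simple k k b′ → Set
  Distinct ws t = Unique (map (entries t) ws)

  distinct? : ∀ ws t → Dec (Distinct ws t)
  distinct? ws t = DecUnique.unique? _≟²_ (map (entries t) ws)

  #distinct : List (Bits k) → ℕ
  #distinct ws = ∑ (list tables) (𝟙 ∘ distinct? ws)

  private
    τ : Bits k → Bits k × Bits k → Simple k k b × Simple k k b′ → Simple k k b × Simple k k b′
    τ w (p , q) (T , U) = bump i w p T , bump i′ w q U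

    τ-involutive : ∀ w β t → τ w β (τ w β t) ≡ t
    τ-involutive w (p , q) (T , U) = cong₂ _,_ (bump-involutive i w p T) (bump-involutive i′ w q U)

    _⊕²_ : Bits k × Bits k → Bits k × Bits k → Bits k × Bits k
    (p , q) ⊕² (v , v′) = p ⊕ v , q ⊕ v′

    ⊕²-cancelʳ : ∀ β v → (β ⊕² v) ⊕² v ≡ β
    ⊕²-cancelʳ (p , q) (v , v′) = cong₂ _,_ (⊕-cancelʳ p v) (⊕-cancelʳ q v′)

    entries-hit : ∀ w β t → entries (τ w β t) w ≡ β ⊕² entries t w
    entries-hit w (p , q) (T , U) = cong₂ _,_ (lookup-bump-hit i w p T) (lookup-bump-hit i′ w q U)

    entries-miss : ∀ w β t {ws} → All (w ≢_) ws → map (entries (τ w β t)) ws ≡ map (entries t) ws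
    entries-miss w β       t       []        = refl
    entries-miss w (p , q) (T , U) (ne ∷ ps) = cong₂ _∷_
      (cong₂ _,_ (lookup-bump-miss i p T (ne ∘ sym)) (lookup-bump-miss i′ q U (ne ∘ sym)))
      (entries-miss w (p , q) (T , U) ps)

    distinct-∷ : ∀ {w ws} β t → All (w ≢_) ws → Distinct (w ∷ ws) (τ w β t) →
      (β ⊕² entries t w) ∉ map (entries t) ws × Distinct ws t
    distinct-∷ {w} {ws} β t w∉ (v∉ ∷ u) =
      (λ v∈ → All¬⇒¬Any v∉ (subst (_∈ map (entries (τ w β t)) ws) (sym (entries-hit w β t))
                (subst (_ ∈_) (sym (entries-miss w β t w∉)) v∈))) ,
      subst Unique (entries-miss w β t w∉) u

  open DecMembership _≟²_ using (_∈?_)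

  -- Translation by `v` is a bijection of the n² shifts, so each element of `vs` rules out a shift
  -- of its own.
  avoiding : ∀ (v : Bits k × Bits k) {vs} → Unique vs →
    ∑ Σ² (λ β → 𝟙 (¬? ((β ⊕² v) ∈? vs))) + length vs ≤ 2 ^ k * 2 ^ k
  avoiding v {vs} u = begin
    ∑ Σ² (λ β → 𝟙 (¬? ((β ⊕² v) ∈? vs))) + length vs
      ≤⟨ +-monoʳ-≤ _ hits ⟩
    ∑ Σ² (λ β → 𝟙 (¬? ((β ⊕² v) ∈? vs))) + ∑ Σ² (λ β → 𝟙 ((β ⊕² v) ∈? vs))
      ≡⟨ ∑-distrib-+ Σ² ⟨
    ∑ Σ² (λ β → 𝟙 (¬? ((β ⊕² v) ∈? vs)) + 𝟙 ((β ⊕² v) ∈? vs))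
      ≡⟨ ∑-cong Σ² (λ β → 𝟙-¬? ((β ⊕² v) ∈? vs)) ⟩
    ∑ Σ² (λ _ → 1)
      ≡⟨ length-as-∑ Σ² ⟨
    length Σ²
      ≡⟨ ∣Σ²∣ k ⟩
    2 ^ k * 2 ^ k ∎
    where
    open ≤-Reasoning
    Hit? : Decidable (λ β → (β ⊕² v) ∈ vs)
    Hit? β = (β ⊕² v) ∈? vs

    ⊕²-injective : ∀ {β β′} → β ⊕² v ≡ β′ ⊕² v → β ≡ β′
    ⊕²-injective {β} {β′} e = trans (sym (⊕²-cancelʳ β v)) (trans (cong (_⊕² v) e) (⊕²-cancelʳ β′ v))

    member : ∀ {β} → β ∈ map (_⊕² v) vs → β ∈ filter Hit? Σ²
    member {β} β∈ with β′ , β′∈ , refl ← ∈-map⁻ (_⊕² v) β∈ =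
      ∈-filter⁺ Hit? (complete (cartesianProductᵉ (bitsᵉ k) (bitsᵉ k)) β) (subst (_∈ vs) (sym (⊕²-cancelʳ β′ v)) β′∈)

    hits : length vs ≤ ∑ Σ² (𝟙 ∘ Hit?)
    hits = begin
      length vs                  ≡⟨ length-map (_⊕² v) vs ⟨
      length (map (_⊕² v) vs)    ≤⟨ length-unique-⊆ _≟²_ (Unique.map⁺ ⊕²-injective u) member ⟩
      length (filter Hit? Σ²)    ≡⟨ length-filter-as-∑ Hit? Σ² ⟩
      ∑ Σ² (𝟙 ∘ Hit?)            ∎

  -- Resampling the entry of the fresh `w` leaves the entries of `ws` alone, and distinctness
  -- survives with probability at most 1 - |ws|/n². The lost share is kept on the left to avoid
  -- subtraction.
  #distinct-∷ : ∀ {w ws} → All (w ≢_) ws →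
    2 ^ k * 2 ^ k * #distinct (w ∷ ws) + length ws * #distinct ws ≤ 2 ^ k * 2 ^ k * #distinct ws
  #distinct-∷ {w} {ws} w∉ = begin
    N * #distinct (w ∷ ws) + length ws * #distinct ws
      ≡⟨ cong (λ z → z * #distinct (w ∷ ws) + length ws * #distinct ws) (∣Σ²∣ k) ⟨
    length Σ² * #distinct (w ∷ ws) + length ws * #distinct ws
      ≡⟨ cong₂ _+_ (∑-resample tables Σ² (τ w) (τ-involutive w) _) (sym (∑-distribˡ-* X (length ws))) ⟩
    ∑ X (λ t → ∑ Σ² (λ β → 𝟙 (distinct? (w ∷ ws) (τ w β t)))) + ∑ X (λ t → length ws * 𝟙 (distinct? ws t))
      ≡⟨ ∑-distrib-+ X ⟨
    ∑ X (λ t → ∑ Σ² (λ β → 𝟙 (distinct? (w ∷ ws) (τ w β t))) + length ws * 𝟙 (distinct? ws t))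
      ≤⟨ ∑-mono X pointwise ⟩
    ∑ X (λ t → N * 𝟙 (distinct? ws t))
      ≡⟨ ∑-distribˡ-* X N ⟩
    N * #distinct ws ∎
    where
    open ≤-Reasoning
    N = 2 ^ k * 2 ^ k
    X = list tables

    pointwise : ∀ t → ∑ Σ² (λ β → 𝟙 (distinct? (w ∷ ws) (τ w β t))) + length ws * 𝟙 (distinct? ws t) ≤ N * 𝟙 (distinct? ws t)
    pointwise t with distinct? ws t
    ... | no ¬u = ≤-trans (≤-reflexive (cong₂ _+_
      (∑-𝟙-none (λ β → distinct? (w ∷ ws) (τ w β t)) Σ² (λ β → ¬u ∘ proj₂ ∘ distinct-∷ β t w∉))
      (*-zeroʳ (length ws)))) z≤n
    ... | yes u = begin
      ∑ Σ² (λ β → 𝟙 (distinct? (w ∷ ws) (τ w β t))) + length ws * 1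
        ≤⟨ +-mono-≤ (∑-mono Σ² (λ β → 𝟙-mono (distinct? (w ∷ ws) (τ w β t)) (¬? ((β ⊕² entries t w) ∈? map (entries t) ws))
                                       (proj₁ ∘ distinct-∷ β t w∉)))
                    (≤-reflexive (trans (*-identityʳ _) (sym (length-map (entries t) ws)))) ⟩
      ∑ Σ² (λ β → 𝟙 (¬? ((β ⊕² entries t w) ∈? map (entries t) ws))) + length (map (entries t) ws)
        ≤⟨ avoiding (entries t w) u ⟩
      N      ≡⟨ *-identityʳ N ⟨
      N * 1  ∎

  -- ∏ᵢ (1 − i/N) ≤ 1 / (1 + ∑ᵢ i/N), cleared of denominators.
  #distinct-bound : ∀ {ws} → Unique ws →
    (2 ^ k * 2 ^ k + tri (length ws)) * #distinct ws ≤ 2 ^ k * 2 ^ k * ∣ tables ∣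
  #distinct-bound {[]} [] = begin
    (N + 0) * #distinct []  ≡⟨ cong (_* #distinct []) (+-identityʳ N) ⟩
    N * #distinct []        ≤⟨ *-monoʳ-≤ N (∑-mono (list tables) (𝟙≤1 ∘ distinct? [])) ⟩
    N * ∑ (list tables) (λ _ → 1) ≡⟨ cong (N *_) (length-as-∑ (list tables)) ⟨
    N * ∣ tables ∣          ∎
    where
    open ≤-Reasoning
    N = 2 ^ k * 2 ^ k
  #distinct-bound {w ∷ ws} (w∉ ∷ u) = begin
    (N + (m + tri m)) * d′           ≡⟨ expand N m (tri m) d′ ⟩
    (N * d′ + m * d′) + tri m * d′   ≤⟨ +-mono-≤ (+-monoʳ-≤ (N * d′) (*-monoʳ-≤ m d′≤d)) (*-monoʳ-≤ (tri m) d′≤d) ⟩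
    (N * d′ + m * d) + tri m * d     ≤⟨ +-monoˡ-≤ (tri m * d) (#distinct-∷ w∉) ⟩
    N * d + tri m * d                ≡⟨ *-distribʳ-+ d N (tri m) ⟨
    (N + tri m) * d                  ≤⟨ #distinct-bound u ⟩
    N * ∣ tables ∣                   ∎
    where
    open ≤-Reasoning
    N  = 2 ^ k * 2 ^ k
    m  = length ws
    d  = #distinct ws
    d′ = #distinct (w ∷ ws)
    d′≤d : d′ ≤ d
    d′≤d = ∑-mono (list tables) (λ t → 𝟙-mono (distinct? (w ∷ ws) t) (distinct? ws t) λ { (_ ∷ u) → u })
    expand : ∀ N m t d → (N + (m + t)) * d ≡ (N * d + m * d) + t * d
    expand = solve-∀

-- With m = |W| and n = 4m this says that 16 m² is at most 64 times m(m - 1)/2, which holds as m - 1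
-- ≥ m/2.
n²≤64*tri : ∀ m → 2 ≤ m → 2 * (2 * m) * (2 * (2 * m)) ≤ 64 * tri m
n²≤64*tri m 2≤m = +-cancelʳ-≤ (32 * m) _ _ (begin
  2 * (2 * m) * (2 * (2 * m)) + 32 * m   ≡⟨ e₁ m ⟩
  16 * (m * m) + 16 * (2 * m)            ≤⟨ +-monoʳ-≤ (16 * (m * m)) (*-monoʳ-≤ 16 (*-monoˡ-≤ m 2≤m)) ⟩
  16 * (m * m) + 16 * (m * m)            ≡⟨ e₂ (m * m) ⟩
  32 * (m * m)                           ≡⟨ cong (32 *_) (2*tri m) ⟨
  32 * (2 * tri m + m)                   ≡⟨ e₃ (tri m) m ⟩
  64 * tri m + 32 * m                    ∎)
  where
  open ≤-Reasoning
  e₁ : ∀ m → 2 * (2 * m) * (2 * (2 * m)) + 32 * m ≡ 16 * (m * m) + 16 * (2 * m)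
  e₁ = solve-∀
  e₂ : ∀ s → 16 * s + 16 * s ≡ 32 * s
  e₂ = solve-∀
  e₃ : ∀ t m → 32 * (2 * t + m) ≡ 64 * t + 32 * m
  e₃ = solve-∀

-- Distinctness has density at most N/(N + t), and t ≥ N/64 turns this into 64/65.
#distinct-fraction : ∀ N t d M → .{{NonZero N}} → N ≤ 64 * t → (N + t) * d ≤ N * M → 65 * d ≤ 64 * M
#distinct-fraction N t d M N≤ h = *-cancelˡ-≤ N (begin
  N * (65 * d)               ≡⟨ e₁ N d ⟩
  64 * (N * d) + N * d       ≤⟨ +-monoʳ-≤ (64 * (N * d)) (*-monoˡ-≤ d N≤) ⟩
  64 * (N * d) + 64 * t * d  ≡⟨ e₂ N t d ⟩
  64 * ((N + t) * d)         ≤⟨ *-monoʳ-≤ 64 h ⟩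
  64 * (N * M)               ≡⟨ e₃ N M ⟩
  N * (64 * M)               ∎)
  where
  open ≤-Reasoning
  e₁ : ∀ N d → N * (65 * d) ≡ 64 * (N * d) + N * d
  e₁ = solve-∀
  e₂ : ∀ N t d → 64 * (N * d) + 64 * t * d ≡ 64 * ((N + t) * d)
  e₂ = solve-∀
  e₃ : ∀ N M → 64 * (N * M) ≡ N * (64 * M)
  e₃ = solve-∀

-- Rectangles among derived keys

Quad : ℕ → ℕ → Set
Quad k c = Key k c × Key k c × Key k c × Key k c

quads : List (Key k c) → List (Quad k c)
quads L = cartesianProduct L (cartesianProduct L (cartesianProduct L L))

DerivedRect : ∀ d → Derivers k c d → Quad k c → Set
DerivedRect d D (x₁ , x₂ , x₃ , x₄) =
  Rect (derivedKey d D x₁) (derivedKey d D x₂) (derivedKey d D x₃) (derivedKey d D x₄)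

-- Existence over all quadruples, because which keys form a rectangle depends on the tables drawn so
-- far.
HasRect : List (Key k c) → ∀ d → Derivers k c d → Set
HasRect L d D = Any (DerivedRect d D) (quads L)

hasRect? : ∀ (L : List (Key k c)) d D → Dec (HasRect L d D)
hasRect? L d D = Any.any?
  (λ (x₁ , x₂ , x₃ , x₄) → rect? (derivedKey d D x₁) (derivedKey d D x₂) (derivedKey d D x₃) (derivedKey d D x₄)) (quads L)

#rect : List (Key k c) → ℕ → ℕ
#rect {k} {c} L d = ∑ (allDerivers k c d) (𝟙 ∘ hasRect? L d)

-- At a concrete d, comparing the two sides by unfolding is prohibitively slow;
-- rewriting along this equation is not.
#rect-unfold : ∀ (L : List (Key k c)) d → ∑ (allDerivers k c d) (𝟙 ∘ hasRect? L d) ≡ #rect L d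
#rect-unfold L d = refl

-- With the earlier tables fixed, any one of their rectangles is followed and only the new table is
-- averaged; for a lower bound this one quadruple is enough.
#rect-step : 2 ≤ 2 ^ k → ∀ (L : List (Key k c)) d →
  length (allSimple k k (d + c)) * (3 * (2 ^ k ∸ 1)) * #rect L d ≤ 2 ^ k * 2 ^ k * #rect L (suc d)
#rect-step {k} {c} 2≤n L d = begin
  α * #rect L d                                                  ≡⟨ ∑-distribˡ-* Ds α ⟨
  ∑ Ds (λ D → α * 𝟙 (hasRect? L d D))                            ≤⟨ ∑-mono Ds pointwise ⟩
  ∑ Ds (λ D → N * ∑ X (λ T → 𝟙 (hasRect? L (suc d) (D , T))))    ≡⟨ ∑-distribˡ-* Ds N ⟩
  N * ∑ Ds (λ D → ∑ X (λ T → 𝟙 (hasRect? L (suc d) (D , T))))    ≡⟨ cong (N *_) (∑-cartesianProductWith _,_ Ds X _) ⟨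
  N * #rect L (suc d)                                            ∎
  where
  open ≤-Reasoning
  N  = 2 ^ k * 2 ^ k
  X  = allSimple k k (d + c)
  α  = length X * (3 * (2 ^ k ∸ 1))
  Ds = allDerivers k c d

  pointwise : ∀ D → α * 𝟙 (hasRect? L d D) ≤ N * ∑ X (λ T → 𝟙 (hasRect? L (suc d) (D , T)))
  pointwise D with hasRect? L d D
  ... | no _  = ≤-trans (≤-reflexive (*-zeroʳ α)) z≤n
  ... | yes h with (x₁ , x₂ , x₃ , x₄) , q∈ , R ← find h = ≤-trans (≤-reflexive (*-identityʳ α))
    (Rect-step 2≤n (derivedKey d D x₁) (derivedKey d D x₂) (derivedKey d D x₃) (derivedKey d D x₄) R
      (λ T → hasRect? L (suc d) (D , T)) (λ T → lose q∈))

#rect-iterate : 2 ≤ 2 ^ k → ∀ (L : List (Key k c)) q → length (allDerivers k c 2) ≤ q * #rect L 2 → ∀ e →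
  length (allDerivers k c (2 + e)) * (3 * (2 ^ k ∸ 1)) ^ e ≤ q * (2 ^ k * 2 ^ k) ^ e * #rect L (2 + e)
#rect-iterate {k} {c} 2≤n L q base zero =
  subst₂ (λ D q → D ≤ q * #rect L 2) (sym (*-identityʳ (length (allDerivers k c 2)))) (sym (*-identityʳ q)) base
#rect-iterate {k} {c} 2≤n L q base (suc e) = begin
  length (allDerivers k c (3 + e)) * (α * α ^ e)
    ≡⟨ cong (_* (α * α ^ e)) (length-cartesianProductWith _,_ (allDerivers k c (2 + e)) (allSimple k k (2 + e + c))) ⟩
  length (allDerivers k c (2 + e)) * x * (α * α ^ e)
    ≡⟨ e₁ (length (allDerivers k c (2 + e))) x α (α ^ e) ⟩
  length (allDerivers k c (2 + e)) * α ^ e * (x * α)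
    ≤⟨ *-monoˡ-≤ (x * α) (#rect-iterate 2≤n L q base e) ⟩
  q * N ^ e * #rect L (2 + e) * (x * α)
    ≡⟨ e₂ (q * N ^ e) (#rect L (2 + e)) (x * α) ⟩
  q * N ^ e * (x * α * #rect L (2 + e))
    ≤⟨ *-monoʳ-≤ (q * N ^ e) (#rect-step 2≤n L (2 + e)) ⟩
  q * N ^ e * (N * #rect L (3 + e))
    ≡⟨ e₃ q (N ^ e) N (#rect L (3 + e)) ⟩
  q * (N * N ^ e) * #rect L (3 + e) ∎
  where
  open ≤-Reasoning
  α = 3 * (2 ^ k ∸ 1)
  N = 2 ^ k * 2 ^ k
  x = length (allSimple k k (2 + e + c))
  e₁ : ∀ D x A P → D * x * (A * P) ≡ D * P * (x * A)
  e₁ = solve-∀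
  e₂ : ∀ a g b → a * g * b ≡ a * (b * g)
  e₂ = solve-∀
  e₃ : ∀ q P N g → q * P * (N * g) ≡ q * (N * P) * g
  e₃ = solve-∀

simple-collide₁ : ∀ (T : Simple k b (suc c)) (z : Key k c) {w w′} →
  lookup T (fromℕ c) [ w ] ≡ lookup T (fromℕ c) [ w′ ] → simple T (z ∷ʳ w) ≡ simple T (z ∷ʳ w′)
simple-collide₁ (t ∷ [])     []      e = cong (_⊕ replicate _ false) e
simple-collide₁ (t ∷ u ∷ T)  (a ∷ z) e = cong (t [ a ] ⊕_) (simple-collide₁ (u ∷ T) z e)

simple-collide₂ : ∀ (T : Simple k b (2 + c)) (z : Key k c) {w w′} v →
  lookup T (inject₁ (fromℕ c)) [ w ] ≡ lookup T (inject₁ (fromℕ c)) [ w′ ] →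
  simple T (z ∷ʳ w ∷ʳ v) ≡ simple T (z ∷ʳ w′ ∷ʳ v)
simple-collide₂ (t ∷ u ∷ []) []      v e = cong (_⊕ (u [ v ] ⊕ replicate _ false)) e
simple-collide₂ (t ∷ u ∷ T)  (a ∷ z) v e = cong (t [ a ] ⊕_) (simple-collide₂ (u ∷ T) z v e)

-- The selected keys and their twisted grid

module Construction (k′ c′ : ℕ) where

  k₀ c₀ : ℕ
  k₀ = 2 + k′
  c₀ = 2 + c′

  S : List (Bits k₀)
  S = map (λ v → false ∷ false ∷ v) (allBits k′)

  S-unique : Unique S
  S-unique = Unique.map⁺ (∷-injectiveʳ ∘ ∷-injectiveʳ) (unique (bitsᵉ k′))

  ∣S∣ : length S ≡ 2 ^ k′
  ∣S∣ = trans (length-map _ (allBits k′)) (∣allBits∣ k′)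

  Low : Bits k₀ → Set
  Low (p ∷ q ∷ _) = p ≡ false × q ≡ false

  low? : ∀ x → Dec (Low x)
  low? (p ∷ q ∷ _) = (p Bool.≟ false) ×-dec (q Bool.≟ false)

  Low⇒∈S : ∀ {x} → Low x → x ∈ S
  Low⇒∈S {_ ∷ _ ∷ x} (refl , refl) = ∈-map⁺ _ (complete (bitsᵉ k′) x)

  ∈S⇒Low : ∀ {x} → x ∈ S → Low x
  ∈S⇒Low x∈ with _ , _ , refl ← ∈-map⁻ _ x∈ = refl , refl

  Low-⊕ : ∀ {x y} → Low x → Low y → Low (x ⊕ y)
  Low-⊕ {_ ∷ _ ∷ _} {_ ∷ _ ∷ _} (refl , refl) (refl , refl) = refl , refl

  0ᵇ 1ᵇ : Bits k₀
  0ᵇ = replicate k₀ false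
  1ᵇ = replicate k₀ true

  zᵃ zᵇ : Key k₀ (suc c′)
  zᵃ = 0ᵇ ∷ replicate c′ 0ᵇ
  zᵇ = 1ᵇ ∷ replicate c′ 0ᵇ

  L : List (Key k₀ c₀)
  L = map (zᵃ ∷ʳ_) S ++ map (zᵇ ∷ʳ_) S

  ∣L∣ : length L ≡ 2 * 2 ^ k′
  ∣L∣ = trans (length-++ (map (zᵃ ∷ʳ_) S)) (cong₂ _+_ (trans (length-map _ S) ∣S∣)
    (trans (length-map _ S) (trans ∣S∣ (sym (+-identityʳ _)))))

  X₀ : List (Simple k₀ k₀ (suc c′))
  X₀ = allSimple k₀ k₀ (suc c′)

  -- The twist moves the two copies of `S` to cosets of `S` whose representatives differ by this
  -- value, so the cosets agree exactly when it lies in `S`.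
  shift : Simple k₀ k₀ (suc c′) → Bits k₀
  shift T = simple T zᵃ ⊕ simple T zᵇ

  -- At position zero the entry of `1ᵇ` is read by `zᵇ` but not by `zᵃ`. Xoring one of four two-bit
  -- prefixes into it shifts `shift T` by that prefix, and the prefix equal to the leading two bits
  -- clears them.
  ∑-low-shift : length X₀ ≤ 4 * ∑ X₀ (λ T → 𝟙 (low? (shift T)))
  ∑-low-shift = begin
    length X₀                                                ≡⟨ length-as-∑ X₀ ⟩
    ∑ X₀ (λ _ → 1)                                           ≤⟨ ∑-mono X₀ pointwise ⟩
    ∑ X₀ (λ T → ∑ prefixes (λ p → 𝟙 (low? (shift (τ p T))))) ≡⟨ ∑-resample (simpleᵉ k₀ k₀ (suc c′)) prefixes τ
                                                                  (bump-involutive zero 1ᵇ) _ ⟨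
    4 * ∑ X₀ (λ T → 𝟙 (low? (shift T)))                      ∎
    where
    open ≤-Reasoning
    pad : Bool → Bool → Bits k₀
    pad p q = p ∷ q ∷ replicate k′ false

    prefixes : List (Bits k₀)
    prefixes = pad false false ∷ pad false true ∷ pad true false ∷ pad true true ∷ []

    pad∈ : ∀ p q → pad p q ∈ prefixes
    pad∈ false false = here refl
    pad∈ false true  = there (here refl)
    pad∈ true  false = there (there (here refl))
    pad∈ true  true  = there (there (there (here refl)))

    τ : Bits k₀ → Simple k₀ k₀ (suc c′) → Simple k₀ k₀ (suc c′)
    τ = bump zero 1ᵇ

    shift-τ : ∀ p T → shift (τ p T) ≡ p ⊕ shift T
    shift-τ p T = trans (cong₂ _⊕_ (simple-bump-miss zero {1ᵇ} p T zᵃ (λ ())) (simple-bump-hit zero {1ᵇ} p T zᵇ refl))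
      (⊕-swap (simple T zᵃ) p (simple T zᵇ))

    lowering : ∀ x → ∃₂ λ p q → Low (pad p q ⊕ x)
    lowering (p ∷ q ∷ _) = p , q , Bool.xor-same p , Bool.xor-same q

    pointwise : ∀ T → 1 ≤ ∑ prefixes (λ p → 𝟙 (low? (shift (τ p T))))
    pointwise T with p , q , low ← lowering (shift T) = ≤-trans
      (≤-reflexive (sym (𝟙-yes (low? (shift (τ (pad p q) T))) (subst Low (sym (shift-τ (pad p q) T)) low))))
      (term≤∑ {f = λ p → 𝟙 (low? (shift (τ p T)))} (pad∈ p q))

  preimage : Simple k₀ k₀ (suc c′) → Key k₀ (suc c′) → Bits k₀ → Key k₀ c₀
  preimage T z w = z ∷ʳ (simple T z ⊕ w)

  twist-preimage : ∀ T z w → derivedKey {c = c₀} 0 T (preimage T z w) ≡ z ∷ʳ w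
  twist-preimage T z w = trans
    (cong₂ (λ z′ u → z′ ∷ʳ (u ⊕ simple T z′)) (init-∷ʳ _ z) (last-∷ʳ _ z))
    (cong (z ∷ʳ_) (trans (cong (_⊕ simple T z) (⊕-comm (simple T z) w)) (⊕-cancelʳ w (simple T z))))

  W : Simple k₀ k₀ (suc c′) → List (Bits k₀)
  W T = map (simple T zᵃ ⊕_) S

  -- For w = `simple T zᵃ ⊕ s` the two preimages end in `s` and in `shift T ⊕ s`; the latter is in
  -- `S` because `S` is closed under xor.
  preimage∈L : ∀ T → Low (shift T) → ∀ {w} → w ∈ W T → preimage T zᵃ w ∈ L × preimage T zᵇ w ∈ L
  preimage∈L T low w∈ with s , s∈ , refl ← ∈-map⁻ (simple T zᵃ ⊕_) w∈ =
    ∈-++⁺ˡ (∈-map⁺ (zᵃ ∷ʳ_) (subst (_∈ S) (sym (⊕-cancel (simple T zᵃ) s)) s∈)) ,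
    ∈-++⁺ʳ (map (zᵃ ∷ʳ_) S) (∈-map⁺ (zᵇ ∷ʳ_) (subst (_∈ S) shifted (Low⇒∈S (Low-⊕ low (∈S⇒Low s∈)))))
    where
    shifted : shift T ⊕ s ≡ simple T zᵇ ⊕ (simple T zᵃ ⊕ s)
    shifted = trans (cong (_⊕ s) (⊕-comm (simple T zᵃ) (simple T zᵇ))) (⊕-assoc (simple T zᵇ) (simple T zᵃ) s)

  Rect-grid : ∀ {w w′} → w ≢ w′ → Rect (zᵃ ∷ʳ w) (zᵇ ∷ʳ w) (zᵃ ∷ʳ w′) (zᵇ ∷ʳ w′)
  Rect-grid {w} {w′} w≢w′ =
    (zero , refl , λ ()) ,
    (fromℕ (suc c′) ,
      trans (lookup-∷ʳ-fromℕ zᵃ w) (sym (lookup-∷ʳ-fromℕ zᵇ w)) ,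
      λ e → w≢w′ (trans (sym (lookup-∷ʳ-fromℕ zᵃ w)) (trans e (lookup-∷ʳ-fromℕ zᵃ w′)))) ,
    AllPaired-∷ʳ zᵃ zᵇ zᵃ zᵇ (λ _ → inj₂ (inj₁ (refl , refl))) (inj₁ (refl , refl))

  -- Both positions are that of the twisted character: the last one read for the first derived
  -- character, and the last but one for the second.
  open Birthday {k₀} {c₀} {suc c₀} (fromℕ (suc c′)) (inject₁ (fromℕ (suc c′)))

  module _ (T₀ : Simple k₀ k₀ (suc c′)) (T₁ : Simple k₀ k₀ c₀) (T₂ : Simple k₀ k₀ (suc c₀)) where

    extend₁ : Key k₀ c₀ → Key k₀ (suc c₀)
    extend₁ y = y ∷ʳ simple T₁ y

    extend₂ : Key k₀ (suc c₀) → Key k₀ (2 + c₀)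
    extend₂ y = y ∷ʳ simple T₂ y

    -- A colliding pair w, w′ spans a rectangle of the grid. Both depths are delivered because d = 1
    -- is settled by the same collision with `T₂` ignored.
    collision⇒HasRect : Low (shift T₀) → ¬ Distinct (W T₀) (T₁ , T₂) →
      HasRect L 1 (T₀ , T₁) × HasRect L 2 ((T₀ , T₁) , T₂)
    collision⇒HasRect low ¬distinct
      with w , w′ , w∈ , w′∈ , w≢w′ , e ← ∃-collision _≟²_ (entries (T₁ , T₂))
             (Unique.map⁺ (⊕-injectiveˡ (simple T₀ zᵃ)) S-unique) ¬distinct
      = lose quad∈ (resp extend₁ R₁) , lose quad∈ (resp (extend₂ ∘ extend₁) R₂)
      where
      quad : Quad k₀ c₀
      quad = preimage T₀ zᵃ w , preimage T₀ zᵇ w , preimage T₀ zᵃ w′ , preimage T₀ zᵇ w′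

      quad∈ : quad ∈ quads L
      quad∈ with m₁ , m₂ ← preimage∈L T₀ low w∈ | m₃ , m₄ ← preimage∈L T₀ low w′∈ =
        ∈-cartesianProduct⁺ m₁ (∈-cartesianProduct⁺ m₂ (∈-cartesianProduct⁺ m₃ m₄))

      e₁ : ∀ z → simple T₁ (z ∷ʳ w) ≡ simple T₁ (z ∷ʳ w′)
      e₁ z = simple-collide₁ T₁ z (,-injectiveˡ e)

      e₂ : ∀ z → simple T₂ (extend₁ (z ∷ʳ w)) ≡ simple T₂ (extend₁ (z ∷ʳ w′))
      -- By `e₁` the first derived characters already agree, so the keys read by `T₂` differ in w
      -- and w′ only.
      e₂ z = trans (simple-collide₂ T₂ z (simple T₁ (z ∷ʳ w)) (,-injectiveʳ e))
        (cong (λ v → simple T₂ (z ∷ʳ w′ ∷ʳ v)) (e₁ z))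

      R₁ : Rect (extend₁ (zᵃ ∷ʳ w)) (extend₁ (zᵇ ∷ʳ w)) (extend₁ (zᵃ ∷ʳ w′)) (extend₁ (zᵇ ∷ʳ w′))
      R₁ = Rect-∷ʳ (zᵃ ∷ʳ w) (zᵇ ∷ʳ w) (zᵃ ∷ʳ w′) (zᵇ ∷ʳ w′) (Rect-grid w≢w′) (inj₂ (inj₁ (e₁ zᵃ , e₁ zᵇ)))

      R₂ : Rect (extend₂ (extend₁ (zᵃ ∷ʳ w))) (extend₂ (extend₁ (zᵇ ∷ʳ w)))
                (extend₂ (extend₁ (zᵃ ∷ʳ w′))) (extend₂ (extend₁ (zᵇ ∷ʳ w′)))
      R₂ = Rect-∷ʳ (extend₁ (zᵃ ∷ʳ w)) (extend₁ (zᵇ ∷ʳ w)) (extend₁ (zᵃ ∷ʳ w′)) (extend₁ (zᵇ ∷ʳ w′))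
        R₁ (inj₂ (inj₁ (e₂ zᵃ , e₂ zᵇ)))

      resp : ∀ {b} (F : Key k₀ c₀ → Key k₀ b) →
        Rect (F (zᵃ ∷ʳ w)) (F (zᵇ ∷ʳ w)) (F (zᵃ ∷ʳ w′)) (F (zᵇ ∷ʳ w′)) →
        Rect (F (derivedKey {c = c₀} 0 T₀ (preimage T₀ zᵃ w))) (F (derivedKey {c = c₀} 0 T₀ (preimage T₀ zᵇ w)))
             (F (derivedKey {c = c₀} 0 T₀ (preimage T₀ zᵃ w′))) (F (derivedKey {c = c₀} 0 T₀ (preimage T₀ zᵇ w′)))
      resp F = subst₄ (cong F (sym (twist-preimage T₀ zᵃ w))) (cong F (sym (twist-preimage T₀ zᵇ w)))
                      (cong F (sym (twist-preimage T₀ zᵃ w′))) (cong F (sym (twist-preimage T₀ zᵇ w′)))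
        where
        subst₄ : ∀ {b} {y₁ y₂ y₃ y₄ y₁′ y₂′ y₃′ y₄′ : Key k₀ b} → y₁ ≡ y₁′ → y₂ ≡ y₂′ → y₃ ≡ y₃′ → y₄ ≡ y₄′ →
          Rect y₁ y₂ y₃ y₄ → Rect y₁′ y₂′ y₃′ y₄′
        subst₄ refl refl refl refl R = R

  few-distinct : 2 ≤ 2 ^ k′ → ∀ T₀ → 65 * #distinct (W T₀) ≤ 64 * ∣ tables ∣
  few-distinct 2≤m T₀ = #distinct-fraction (2 ^ k₀ * 2 ^ k₀) (tri (2 ^ k′)) (#distinct (W T₀)) ∣ tables ∣
    {{m*n≢0 (2 ^ k₀) (2 ^ k₀) {{m^n≢0 2 k₀}} {{m^n≢0 2 k₀}}}}
    (n²≤64*tri (2 ^ k′) 2≤m)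
    (subst (λ m → (2 ^ k₀ * 2 ^ k₀ + tri m) * #distinct (W T₀) ≤ 2 ^ k₀ * 2 ^ k₀ * ∣ tables ∣)
      (trans (length-map _ S) ∣S∣)
      (#distinct-bound (Unique.map⁺ (⊕-injectiveˡ (simple T₀ zᵃ)) S-unique)))

  -- The factor 4 pays for the alignment of the cosets and 65 for the collision. `P` is left
  -- abstract so that one count serves both depths.
  ∑-collision : 2 ≤ 2 ^ k′ → {P : Derivers k₀ c₀ 2 → Set} (P? : ∀ D → Dec (P D)) →
    (∀ T₀ T₁ T₂ → HasRect L 1 (T₀ , T₁) × HasRect L 2 ((T₀ , T₁) , T₂) → P ((T₀ , T₁) , T₂)) →
    length (allDerivers k₀ c₀ 2) ≤ 4 * 65 * ∑ (allDerivers k₀ c₀ 2) (𝟙 ∘ P?)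
  ∑-collision 2≤m P? implies = ∑-two-stage X₀ (allSimple k₀ k₀ c₀) (allSimple k₀ k₀ (suc c₀))
    (low? ∘ shift) P? 4 65 ∑-low-shift
    (λ T₀ low → ∑-complement (list tables) (λ t → P? ((T₀ , proj₁ t) , proj₂ t)) (distinct? (W T₀)) 64
      (λ (T₁ , T₂) ¬distinct → implies T₀ T₁ T₂ (collision⇒HasRect T₀ T₁ T₂ low ¬distinct))
      (few-distinct 2≤m T₀))

  #rect-2 : 2 ≤ 2 ^ k′ → length (allDerivers k₀ c₀ 2) ≤ 4 * 65 * #rect L 2
  #rect-2 2≤m = subst (λ g → length (allDerivers k₀ c₀ 2) ≤ 4 * 65 * g) (#rect-unfold L 2)
    (∑-collision 2≤m (hasRect? L 2) (λ _ _ _ → proj₂))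

  #rect-1 : 2 ≤ 2 ^ k′ → length (allDerivers k₀ c₀ 1) ≤ 4 * 65 * #rect L 1
  #rect-1 2≤m = subst (λ g → length (allDerivers k₀ c₀ 1) ≤ 4 * 65 * g) (#rect-unfold L 1)
    (∑-proj₁-cancel (allDerivers k₀ c₀ 1) (allSimple k₀ k₀ (suc c₀)) (4 * 65) (𝟙 ∘ hasRect? L 1)
      {{length-nonZero (complete (simpleᵉ k₀ k₀ (suc c₀)) (replicate _ (replicate _ 0ᵇ)))}}
      (∑-collision 2≤m (hasRect? L 1 ∘ proj₁) (λ _ _ _ → proj₁)))
    where
    length-nonZero : ∀ {A : Set} {x : A} {xs} → x ∈ xs → NonZero (length xs)
    length-nonZero (here _)  = _
    length-nonZero (there _) = _

-- Rational probabilities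

-- `_/_` reduces by a gcd, so the comparison passes through unnormalised fractions, where it is
-- cross multiplication.
/-mono-≤ : ∀ a b c d .{{_ : NonZero b}} .{{_ : NonZero d}} → a * d ≤ c * b → ℤ.+ a / b ℚ.≤ ℤ.+ c / d
/-mono-≤ a (suc b) c (suc d) h = ℚ.toℚᵘ-cancel-≤
  (ℚᵘ.≤-respˡ-≃ (ℚᵘ.≃-sym (ℚ.toℚᵘ-fromℚᵘ (mkℚᵘ (ℤ.+ a) b)))
  (ℚᵘ.≤-respʳ-≃ (ℚᵘ.≃-sym (ℚ.toℚᵘ-fromℚᵘ (mkℚᵘ (ℤ.+ c) d)))
  (ℚᵘ.*≤* (subst (ℤ._≤ _) (ℤ.pos-* a (suc d)) (subst (_ ℤ.≤_) (ℤ.pos-* c (suc b)) (ℤ.+≤+ h))))))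

/-homo-* : ∀ a b c d .{{_ : NonZero b}} .{{_ : NonZero d}} .{{_ : NonZero (b * d)}} →
  (ℤ.+ a / b) ℚ.* (ℤ.+ c / d) ≡ ℤ.+ (a * c) / (b * d)
/-homo-* a (suc b) c (suc d) = ℚ.toℚᵘ-injective (ℚᵘ.≃-trans (ℚ.toℚᵘ-homo-* (ℤ.+ a / suc b) (ℤ.+ c / suc d))
  (ℚᵘ.≃-trans (ℚᵘ.*-cong (ℚ.toℚᵘ-fromℚᵘ (mkℚᵘ (ℤ.+ a) b)) (ℚ.toℚᵘ-fromℚᵘ (mkℚᵘ (ℤ.+ c) d)))
  (ℚᵘ.≃-trans (ℚᵘ.≃-reflexive (cong (λ z → mkℚᵘ z (d + b * suc d)) (sym (ℤ.pos-* a c))))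
  (ℚᵘ.≃-sym (ℚ.toℚᵘ-fromℚᵘ (mkℚᵘ (ℤ.+ (a * c)) (d + b * suc d)))))))

/1-homo-+ : ∀ a b → (ℤ.+ a / 1) ℚ.+ (ℤ.+ b / 1) ≡ ℤ.+ (a + b) / 1
/1-homo-+ a b = ℚ.toℚᵘ-injective (ℚᵘ.≃-trans (ℚ.toℚᵘ-homo-+ (ℤ.+ a / 1) (ℤ.+ b / 1))
  (ℚᵘ.≃-trans (ℚᵘ.+-cong (ℚ.toℚᵘ-fromℚᵘ (mkℚᵘ (ℤ.+ a) 0)) (ℚ.toℚᵘ-fromℚᵘ (mkℚᵘ (ℤ.+ b) 0)))
  (ℚᵘ.≃-trans (ℚᵘ.≃-reflexive (cong (λ z → mkℚᵘ z 0) (cong₂ ℤ._+_ (ℤ.*-identityʳ (ℤ.+ a)) (ℤ.*-identityʳ (ℤ.+ b)))))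
  (ℚᵘ.≃-sym (ℚ.toℚᵘ-fromℚᵘ (mkℚᵘ (ℤ.+ (a + b)) 0))))))

[3/∣Σ∣]^-as-/ : ∀ k e → [3/∣Σ∣]^ k e ≡ (ℤ.+ (3 ^ e) / (2 ^ k) ^ e) {{m^n≢0 (2 ^ k) e {{m^n≢0 2 k}}}}
[3/∣Σ∣]^-as-/ k zero    = refl
[3/∣Σ∣]^-as-/ k (suc e) = trans (cong ((ℤ.+ 3 / (2 ^ k)) ℚ.*_) ([3/∣Σ∣]^-as-/ k e))
  (/-homo-* 3 (2 ^ k) (3 ^ e) ((2 ^ k) ^ e))
  where instance
    n≢0  = m^n≢0 2 k
    nᵉ≢0 = m^n≢0 (2 ^ k) e
    nn≢0 = m^n≢0 (2 ^ k) (suc e)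

-- The element `x` excludes the dummy value of `Pr` on the empty list.
Pr-≥ : ∀ {A : Set} {P : A → Set} {xs} {x : A} → x ∈ xs → (P? : Decidable P) → ∀ a b .{{_ : NonZero b}} →
  a * length xs ≤ length (filter P? xs) * b → ℤ.+ a / b ℚ.≤ Pr xs P?
Pr-≥ {xs = xs@(_ ∷ _)} _ P? a b h = /-mono-≤ a b (length (filter P? xs)) (length xs) h

Pr-≤ : ∀ {A : Set} {P : A → Set} (xs : List A) (P? : Decidable P) n →
  length (filter P? xs) ≤ n * length xs → Pr xs P? ℚ.≤ ℤ.+ n / 1
Pr-≤ []           P? n h = /-mono-≤ 0 1 n 1 z≤n
Pr-≤ xs@(_ ∷ _) P? n h =
  /-mono-≤ (length (filter P? xs)) (length xs) n 1 (subst (_≤ n * length xs) (sym (*-identityʳ _)) h)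

sum-≤ : ∀ {A : Set} (xs : List A) {p : A → ℚ} {g : A → ℕ} → (∀ x → p x ℚ.≤ ℤ.+ g x / 1) →
  foldr ℚ._+_ 0ℚ (map p xs) ℚ.≤ ℤ.+ ∑ xs g / 1
sum-≤ []       h = ℚ.≤-refl
sum-≤ (x ∷ xs) {g = g} h = ℚ.≤-trans (ℚ.+-mono-≤ (h x) (sum-≤ xs h)) (ℚ.≤-reflexive (/1-homo-+ (g x) (∑ xs g)))

T-does : {P : Set} (P? : Dec P) → P → T (does P?)
T-does (yes _) _ = _
T-does (no ¬p) p = contradiction p ¬p

-- The selector of a fixed key set

module Deterministic {k c : ℕ} (L : List (Key k c)) where

  open DecMembership (_≟ᵏ_ {k} {c}) using (_∈?_)

  selector : ∀ r → Selector k r c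
  selector r = record
    { queries        = []
    ; queries-unique = []
    ; select         = λ x _ _ → does (x ∈? L)
    ; select-query   = λ ()
    }

  pᶠ-selector : ∀ r x → pᶠ (selector r) x ℚ.≤ ℤ.+ 𝟙 (x ∈? L) / 1
  -- Without query keys there is a single φ, so the maximum joins one probability with the neutral
  -- 0.
  pᶠ-selector r x = ℚ.⊔-lub (Pr-≤ (allBits r) (λ _ → does (x ∈? L) Bool.≟ true) (𝟙 (x ∈? L)) count)
    (/-mono-≤ 0 1 (𝟙 (x ∈? L)) 1 z≤n)
    where
    open ≤-Reasoning
    count : length (filter (λ _ → does (x ∈? L) Bool.≟ true) (allBits r)) ≤ 𝟙 (x ∈? L) * length (allBits r)
    count with x ∈? L
    ... | yes _ = ≤-trans (length-filter (λ _ → true Bool.≟ true) (allBits r)) (≤-reflexive (sym (+-identityʳ _)))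
    ... | no _  = ≤-reflexive (trans (length-filter-as-∑ (λ _ → false Bool.≟ true) (allBits r))
                    (∑-𝟙-none (λ _ → false Bool.≟ true) (allBits r) (λ _ ())))

  μ-selector : ∀ r → μ (selector r) ℚ.≤ ℤ.+ length L / 1
  μ-selector r = ℚ.≤-trans (sum-≤ (allKeys k c) (pᶠ-selector r))
    (/-mono-≤ (∑ (allKeys k c) (𝟙 ∘ (_∈? L))) 1 (length L) 1 (*-monoˡ-≤ 1 (begin
      ∑ (allKeys k c) (𝟙 ∘ (_∈? L))           ≡⟨ length-filter-as-∑ (_∈? L) (allKeys k c) ⟨
      length (filter (_∈? L) (allKeys k c))   ≤⟨ length-unique-⊆ _≟ᵏ_ (Unique.filter⁺ (_∈? L) (unique (keysᵉ k c)))
                                                   (proj₂ ∘ ∈-filter⁻ (_∈? L) {xs = allKeys k c}) ⟩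
      length L                                ∎)))
    where open ≤-Reasoning

  HasRect⇒LinearlyDependent : ∀ {r} d (D : Derivers k c d) (T̂ : Simple k r (d + c)) →
    HasRect L d D → LinearlyDependent (derivedSelected d (selector r) (D , T̂))
  HasRect⇒LinearlyDependent {r} d D T̂ h
    with (x₁ , x₂ , x₃ , x₄) , q∈ , R ← find h
    with m₁ , m₂₃₄ ← ∈-cartesianProduct⁻ L (cartesianProduct L (cartesianProduct L L)) q∈
    with m₂ , m₃₄ ← ∈-cartesianProduct⁻ L (cartesianProduct L L) m₂₃₄
    with m₃ , m₄ ← ∈-cartesianProduct⁻ L L m₃₄ =
    y x₁ ∷ y x₂ ∷ y x₃ ∷ y x₄ ∷ [] , Rect⇒Unique (y x₁) (y x₂) (y x₃) (y x₄) R ,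
    (derived m₁ ∷ derived m₂ ∷ derived m₃ ∷ derived m₄ ∷ []) , (λ ()) ,
    Rect⇒EvenOccurrences (y x₁) (y x₂) (y x₃) (y x₄) R
    where
    y : Key k c → Key k (d + c)
    y = derivedKey d D

    derived : ∀ {x} → x ∈ L → y x ∈ derivedSelected d (selector r) (D , T̂)
    derived {x} x∈ = ∈-map⁺ y
      (∈-filter⁺ (λ x → Bool.T? (does (x ∈? L))) (complete (keysᵉ k c) x) (T-does (x ∈? L) x∈))

  -- A rectangle is an event of the derivers alone, so every choice of the tables of ĥ contributes
  -- one copy of it.
  #dependent : ∀ r d → length (allSimple k r (d + c)) * #rect L d ≤
    length (filter (λ t → linearlyDependent? (derivedSelected d (selector r) t)) (allTornado k r c d))
  #dependent r d = begin
    length X * #rect L d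
      ≡⟨ ∑-proj₁ (allDerivers k c d) X _ ⟨
    ∑ (allTornado k r c d) (λ (D , _) → 𝟙 (hasRect? L d D))
      ≤⟨ ∑-mono (allTornado k r c d) (λ t → 𝟙-mono (hasRect? L d (proj₁ t)) (dependent? t)
           (HasRect⇒LinearlyDependent d (proj₁ t) (proj₂ t))) ⟩
    ∑ (allTornado k r c d) (𝟙 ∘ dependent?)
      ≡⟨ length-filter-as-∑ dependent? (allTornado k r c d) ⟨
    length (filter dependent? (allTornado k r c d)) ∎
    where
    open ≤-Reasoning
    X = allSimple k r (d + c)
    dependent? : ∀ t → Dec (LinearlyDependent (derivedSelected d (selector r) t))
    dependent? t = linearlyDependent? (derivedSelected d (selector r) t)

  Pr-dependent : ∀ r d e s .{{_ : NonZero s}} →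
    length (allDerivers k c d) * 3 ^ e ≤ s * #rect L d * (2 ^ k) ^ e →
    (ℤ.+ 1 / s) ℚ.* [3/∣Σ∣]^ k e ℚ.≤
      Pr (allTornado k r c d) (λ t → linearlyDependent? (derivedSelected d (selector r) t))
  Pr-dependent r d e s h = ℚ.≤-trans
    (ℚ.≤-reflexive (trans (cong ((ℤ.+ 1 / s) ℚ.*_) ([3/∣Σ∣]^-as-/ k e)) (/-homo-* 1 s (3 ^ e) ((2 ^ k) ^ e))))
    (Pr-≥ {xs = allTornado k r c d}
      (∈-cartesianProduct⁺ (proj₂ (someDeriver d))
        (complete (simpleᵉ k r (d + c)) (replicate _ (replicate _ (replicate _ false)))))
      (λ t → linearlyDependent? (derivedSelected d (selector r) t)) (1 * 3 ^ e) (s * (2 ^ k) ^ e) (begin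
      1 * 3 ^ e * length (allTornado k r c d)
        ≡⟨ cong (1 * 3 ^ e *_) (length-cartesianProductWith _,_ (allDerivers k c d) X) ⟩
      1 * 3 ^ e * (length (allDerivers k c d) * length X)
        ≡⟨ e₁ (3 ^ e) (length (allDerivers k c d)) (length X) ⟩
      length (allDerivers k c d) * 3 ^ e * length X
        ≤⟨ *-monoˡ-≤ (length X) h ⟩
      s * #rect L d * (2 ^ k) ^ e * length X
        ≡⟨ e₂ s (#rect L d) ((2 ^ k) ^ e) (length X) ⟩
      length X * #rect L d * (s * (2 ^ k) ^ e)
        ≤⟨ *-monoˡ-≤ (s * (2 ^ k) ^ e) (#dependent r d) ⟩
      length (filter (λ t → linearlyDependent? (derivedSelected d (selector r) t)) (allTornado k r c d)) * (s * (2 ^ k) ^ e) ∎))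
    where
    open ≤-Reasoning
    instance
      n≢0 = m^n≢0 2 k
      nᵉ≢0 = m^n≢0 (2 ^ k) e
      snᵉ≢0 = m*n≢0 s ((2 ^ k) ^ e)
    X = allSimple k r (d + c)
    e₁ : ∀ p D x → 1 * p * (D * x) ≡ D * p * x
    e₁ = solve-∀
    e₂ : ∀ s g p x → s * g * p * x ≡ x * g * (s * p)
    e₂ = solve-∀
    someDeriver : ∀ d → ∃ (_∈ allDerivers k c d)
    someDeriver zero    = _ , complete (simpleᵉ k k (pred c)) (replicate _ (replicate _ (replicate _ false)))
    someDeriver (suc d) = _ , ∈-cartesianProduct⁺ (proj₂ (someDeriver d))
      (complete (simpleᵉ k k (d + c)) (replicate _ (replicate _ (replicate _ false))))

-- Powers of 1 − 1/n

-- Bernoulli's inequality (1 - 1/n)ᵉ ≥ 1 - e/n with n = m + 1, multiplied by nᵉ⁺¹.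
bernoulli : ∀ m e → suc m ^ e * suc m ≤ suc m * m ^ e + e * suc m ^ e
bernoulli m zero    = ≤-reflexive (cong (_+ 0) (sym (*-identityʳ (suc m)) ))
bernoulli m (suc e) = begin
  n * n ^ e * n                                  ≡⟨ *-assoc n (n ^ e) n ⟩
  n * (n ^ e * n)                                ≤⟨ *-monoʳ-≤ n (bernoulli m e) ⟩
  n * (n * m ^ e + e * n ^ e)                    ≡⟨ split m (m ^ e) e (n ^ e) ⟩
  n * (m * m ^ e) + (n * m ^ e + e * (n * n ^ e)) ≤⟨ +-monoʳ-≤ (n * (m * m ^ e)) (+-monoˡ-≤ (e * (n * n ^ e))
                                                      (*-monoʳ-≤ n (^-monoˡ-≤ e (n≤1+n m)))) ⟩
  n * (m * m ^ e) + (n * n ^ e + e * (n * n ^ e)) ∎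
  where
  open ≤-Reasoning
  n = suc m
  split : ∀ m p e q → (1 + m) * ((1 + m) * p + e * q) ≡ (1 + m) * (m * p) + ((1 + m) * p + e * ((1 + m) * q))
  split = solve-∀

-- For e at most t = n/2 the Bernoulli bound 1 - e/n is at least 1/2.
bernoulli-half : ∀ m t e → suc m ≡ 2 * t → e ≤ t → suc m ^ e ≤ 2 * m ^ e
bernoulli-half m (suc t) e n≡2t e≤t = *-cancelˡ-≤ (suc t) (+-cancelʳ-≤ (suc t * suc m ^ e) _ _ (begin
  suc t * p + suc t * p            ≡⟨ e₁ (suc t) p ⟩
  p * (2 * suc t)                  ≡⟨ cong (p *_) n≡2t ⟨
  p * suc m                        ≤⟨ bernoulli m e ⟩
  suc m * m ^ e + e * p            ≤⟨ +-monoʳ-≤ (suc m * m ^ e) (*-monoˡ-≤ p e≤t) ⟩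
  suc m * m ^ e + suc t * p        ≡⟨ cong (λ n → n * m ^ e + suc t * p) n≡2t ⟩
  2 * suc t * m ^ e + suc t * p    ≡⟨ cong (_+ suc t * p) (e₂ (suc t) (m ^ e)) ⟩
  suc t * (2 * m ^ e) + suc t * p  ∎))
  where
  open ≤-Reasoning
  p = suc m ^ e
  e₁ : ∀ t p → t * p + t * p ≡ p * (2 * t)
  e₁ = solve-∀
  e₂ : ∀ t p → 2 * t * p ≡ t * (2 * p)
  e₂ = solve-∀

-- (1 − 1/n)ᵉ ≥ 2⁻ʲ for e ≤ j n / 2.
power-ratio : ∀ m t j e → suc m ≡ 2 * t → e ≤ j * t → suc m ^ e ≤ 2 ^ j * m ^ e
power-ratio m t zero    zero h e≤ = ≤-refl
power-ratio m t (suc j) e    h e≤ with ≤-total e t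
... | inj₁ e≤t = begin
  suc m ^ e          ≤⟨ bernoulli-half m t e h e≤t ⟩
  2 * m ^ e          ≤⟨ *-monoˡ-≤ (m ^ e) (*-monoʳ-≤ 2 (>-nonZero⁻¹ (2 ^ j) {{m^n≢0 2 j}})) ⟩
  2 ^ suc j * m ^ e  ∎
  where
  open ≤-Reasoning
... | inj₂ t≤e = begin
  suc m ^ e                              ≡⟨ cong (suc m ^_) (m+[n∸m]≡n t≤e) ⟨
  suc m ^ (t + (e ∸ t))                  ≡⟨ ^-distribˡ-+-* (suc m) t (e ∸ t) ⟩
  suc m ^ t * suc m ^ (e ∸ t)            ≤⟨ *-mono-≤ (bernoulli-half m t t h ≤-refl)
                                              (power-ratio m t j (e ∸ t) h (m≤n+o⇒m∸n≤o e t e≤)) ⟩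
  2 * m ^ t * (2 ^ j * m ^ (e ∸ t))      ≡⟨ rearrange (m ^ t) (2 ^ j) (m ^ (e ∸ t)) ⟩
  2 ^ suc j * (m ^ t * m ^ (e ∸ t))      ≡⟨ cong (2 ^ suc j *_) (^-distribˡ-+-* m t (e ∸ t)) ⟨
  2 ^ suc j * m ^ (t + (e ∸ t))          ≡⟨ cong (λ z → 2 ^ suc j * m ^ z) (m+[n∸m]≡n t≤e) ⟩
  2 ^ suc j * m ^ e                      ∎
  where
  open ≤-Reasoning
  rearrange : ∀ a b c → 2 * a * (b * c) ≡ 2 * b * (a * c)
  rearrange = solve-∀

^-distribʳ-* : ∀ e a b → (a * b) ^ e ≡ a ^ e * b ^ e
^-distribʳ-* zero    a b = refl
^-distribʳ-* (suc e) a b = trans (cong (a * b *_) (^-distribʳ-* e a b)) (interchange a b (a ^ e) (b ^ e))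
  where
  interchange : ∀ a b p q → a * b * (p * q) ≡ a * p * (b * q)
  interchange = solve-∀

-- With m = n - 1, the factor (3m/n²)ᵉ splits into (3/n)ᵉ and (1 - 1/n)ᵉ, and the latter is at least
-- 1/R.
clear-powers : ∀ D G q R n m e → .{{NonZero n}} → D * (3 * m) ^ e ≤ q * (n * n) ^ e * G → n ^ e ≤ R * m ^ e →
  D * 3 ^ e ≤ q * R * G * n ^ e
clear-powers D G q R n m e h ratio = *-cancelʳ-≤ _ _ (n ^ e) {{m^n≢0 n e}} (begin
  D * 3 ^ e * n ^ e              ≤⟨ *-monoʳ-≤ (D * 3 ^ e) ratio ⟩
  D * 3 ^ e * (R * m ^ e)        ≡⟨ e₁ D (3 ^ e) R (m ^ e) ⟩
  R * (D * (3 ^ e * m ^ e))      ≡⟨ cong (λ z → R * (D * z)) (^-distribʳ-* e 3 m) ⟨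
  R * (D * (3 * m) ^ e)          ≤⟨ *-monoʳ-≤ R h ⟩
  R * (q * (n * n) ^ e * G)      ≡⟨ cong (λ z → R * (q * z * G)) (^-distribʳ-* e n n) ⟩
  R * (q * (n ^ e * n ^ e) * G)  ≡⟨ e₂ R q (n ^ e) G ⟩
  q * R * G * n ^ e * n ^ e      ∎)
  where
  open ≤-Reasoning
  e₁ : ∀ D p R s → D * p * (R * s) ≡ R * (D * (p * s))
  e₁ = solve-∀
  e₂ : ∀ R q p G → R * (q * (p * p) * G) ≡ q * R * G * p * p
  e₂ = solve-∀

theorem1p7 : ∀ (K : ℕ) → ∃ λ (C : ℚ) → 0ℚ ℚ.< C ×
    (∀ (k r c d : ℕ) → 8 ℕ.≤ k → 2 ℕ.≤ c → 1 ℕ.≤ d → d ℕ.≤ K ℕ.* 2 ℕ.^ k →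
    ∃ λ (f : Selector k r c) →
    μ f ℚ.≤ ℤ.+ (2 ℕ.^ k) / 2 ×
    C ℚ.* [3/∣Σ∣]^ k (d ∸ 2) ℚ.≤ Pr (allTornado k r c d) (λ t → linearlyDependent? (derivedSelected d f t)))
theorem1p7 K = ℤ.+ 1 / s , ℚ.positive⁻¹ (ℤ.+ 1 / s) {{ℚ.normalize-pos 1 s}} , main
  where
  -- The last factor is 4ᴷ: one halving for each of 2K blocks of n/2 derived characters.
  s = 4 * 65 * 2 ^ (K * 2)
  instance
    s≢0 : NonZero s
    s≢0 = m*n≢0 (4 * 65) (2 ^ (K * 2)) {{_}} {{m^n≢0 2 (K * 2)}}

  main : ∀ (k r c d : ℕ) → 8 ℕ.≤ k → 2 ℕ.≤ c → 1 ℕ.≤ d → d ℕ.≤ K ℕ.* 2 ℕ.^ k →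
    ∃ λ (f : Selector k r c) →
    μ f ℚ.≤ ℤ.+ (2 ℕ.^ k) / 2 ×
    (ℤ.+ 1 / s) ℚ.* [3/∣Σ∣]^ k (d ∸ 2) ℚ.≤ Pr (allTornado k r c d) (λ t → linearlyDependent? (derivedSelected d f t))
  main (suc (suc k′)) r (suc (suc c′)) d (s≤s (s≤s 6≤k′)) (s≤s (s≤s _)) 1≤d d≤Kn =
    selector r ,
    ℚ.≤-trans (μ-selector r) (/-mono-≤ (length L) 1 (2 ^ k₀) 2
      (≤-reflexive (trans (cong (_* 2) ∣L∣) (e₁ (2 ^ k′))))) ,
    Pr-dependent r d (d ∸ 2) s (bound d 1≤d d≤Kn)
    where
    open Construction k′ c′
    open Deterministic L

    e₁ : ∀ m → 2 * m * 2 ≡ 2 * (2 * m) * 1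
    e₁ = solve-∀

    2≤m : 2 ≤ 2 ^ k′
    2≤m = ^-monoʳ-≤ 2 (≤-trans (s≤s z≤n) 6≤k′)

    2≤n : 2 ≤ 2 ^ k₀
    2≤n = ≤-trans 2≤m (≤-trans (m≤n*m (2 ^ k′) 4) (≤-reflexive (*-assoc 2 2 (2 ^ k′))))

    n≡ : suc (2 ^ k₀ ∸ 1) ≡ 2 ^ k₀
    n≡ = m+[n∸m]≡n (≤-trans (s≤s z≤n) 2≤n)

    ratio : ∀ e → e ≤ K * 2 ^ k₀ → (2 ^ k₀) ^ e ≤ 2 ^ (K * 2) * (2 ^ k₀ ∸ 1) ^ e
    ratio e e≤ = subst (λ n → n ^ e ≤ 2 ^ (K * 2) * (2 ^ k₀ ∸ 1) ^ e) n≡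
      -- Here t = n/2 = `2 ^ suc k′`, so K n is the same as 2K t.
      (power-ratio (2 ^ k₀ ∸ 1) (2 ^ suc k′) (K * 2) e n≡ (subst (e ≤_) (sym (*-assoc K 2 (2 ^ suc k′))) e≤))

    bound : ∀ d → 1 ≤ d → d ≤ K * 2 ^ k₀ →
      length (allDerivers k₀ c₀ d) * 3 ^ (d ∸ 2) ≤ s * #rect L d * (2 ^ k₀) ^ (d ∸ 2)
    -- Truncated subtraction makes the exponent 0, so a constant lower bound is due, and the
    -- collision in `T₁` provides it.
    bound 1             _ _    = begin
      length (allDerivers k₀ c₀ 1) * 1                ≤⟨ *-monoˡ-≤ 1 (#rect-1 2≤m) ⟩
      4 * 65 * #rect L 1 * 1                          ≤⟨ *-monoˡ-≤ 1 (*-monoˡ-≤ (#rect L 1) (m≤m*n (4 * 65) (2 ^ (K * 2)) {{m^n≢0 2 (K * 2)}})) ⟩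
      s * #rect L 1 * 1                               ∎
      where open ≤-Reasoning
    bound (suc (suc e)) _ d≤Kn = clear-powers (length (allDerivers k₀ c₀ (2 + e))) (#rect L (2 + e)) (4 * 65) (2 ^ (K * 2))
      (2 ^ k₀) (2 ^ k₀ ∸ 1) e {{m^n≢0 2 k₀}}
      (#rect-iterate 2≤n L (4 * 65) (#rect-2 2≤m) e) (ratio e (≤-trans (m≤n+m e 2) d≤Kn))
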